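{- Let $\mathcal{M}$ be the family of $3$-graphs defined in the context, and let $\mathrm{ex}(n,\mathcal{M})$ denote the maximum number of edges in an $\mathcal{M}$-free $3$-graph on $n$ vertices. Then $\mathrm{ex}(n,\mathcal{M}) \le 2n^3/27$ for every positive integer $n$. Moreover, equality $\mathrm{ex}(n,\mathcal{M}) = 2n^3/27$ holds whenever $n$ is a multiple of six.
   Context: A $3$-graph is a set of $3$-element subsets (edges) of a finite vertex set. A $3$-graph $\mathcal{H}$ contains $F$ (written $F\subset\mathcal{H}$) if $\mathcal{H}$ has a subgraph isomorphic to $F$; $\mathcal{H}$ is $\mathcal{M}$-free if it contains no member of $\mathcal{M}$. For $S\subset V(F)$, $F[S]$ is the induced subgraph on $S$. The transversal number $\tau(\mathcal{H})$ is the minimum size of a set $S\subset V(\mathcal{H})$ meeting every edge ($\tau=0$ if $\mathcal{H}$ has no edges). $K_5^{3- }$ is the $3$-graph on $5$ vertices consisting of all but one of the $10$ triples. For $\ell\ge 2$, $\mathcal{K}^3_{\ell+1}$ is the collection of all $3$-graphs $F$ on at most $(\ell+1)+\binom{\ell+1}{2}$ vertices for which there exists an $(\ell+1)$-set $S\subset V(F)$ (a core of $F$) such that every pair of vertices of $S$ is contained in some edge of $F$. Let $\mathcal{G}^1_n$ be the $3$-graph with vertex set $A\cup B$, $A\cap B=\emptyset$, $|A|=\lfloor n/3\rfloor$, $|B|=\lceil 2n/3\rceil$, whose edges are all triples with exactly one vertex in $A$ and two in $B$. Let $\mathcal{G}^2_6$ be the $3$-graph on $[6]$ whose edges are all triples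 of $[6]$ except $\{1,2,3\},\{1,2,6\},\{3,4,5\},\{4,5,6\}$. For a $3$-graph $\mathcal{T}$ on $[s]$ and positive integers $t_1,\dots,t_s$, the blowup $\mathcal{T}(t)$ replaces each vertex $i$ by a set of size $t_i$ (sets pairwise disjoint) and each edge $\{i,j,k\}$ by all triples with one vertex in each of the corresponding three sets. For $n>6$, $\mathcal{G}^2_n$ is a blowup of $\mathcal{G}^2_6$ on $n$ vertices with the maximum number of edges. Define $\mathcal{M}=M_1\cup M_2\cup M_3$ where $M_1=\{K_5^{3- }\}$; $M_2$ is the set of all $F\in\mathcal{K}^3_7$ having a core $S$ with $\tau(F[S])\ge 2$; $M_3$ is the set of all $F\in\mathcal{K}^3_6$ such that $F\not\subset\mathcal{G}^1_n$ and $F\not\subset\mathcal{G}^2_n$ for all positive integers $n$ (for which these are defined). -}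

module Defs where

open import Data.Bool using (Bool; true; false; _∧_; not; if_then_else_)
open import Data.Nat using (ℕ; zero; suc; _+_; _*_; _≤_; _/_; _<_)
open import Data.Nat.Combinatorics using (_C_)
open import Data.Fin using (Fin; toℕ) renaming (zero to f0; suc to fs)
open import Data.Fin.Properties using (any?; _≟_)
open import Data.Fin.Subset using (Subset; _∈_; _∉_; _⊆_; ∣_∣; _∩_)
open import Data.Fin.Subset.Properties using (_∈?_)
open import Data.Vec using (Vec; []; _∷_; tabulate)
open import Data.List using (List; []; _∷_; map; _++_; length; filter)
open import Data.Product using (Σ; ∃; _×_; _,_)
open import Relation.Nullary using (¬_; Dec; yes; no)
open import Relation.Nullary.Decidable using (⌊_⌋; _×-dec_)
open import Relation.Binary.PropositionalEquality using (_≡_; _≢_)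
open import Function.Definitions using (Injective)

-- 3-graphs on the vertex set Fin n.
-- A 3-graph is given by a Boolean predicate on subsets; its edges are
-- exactly the 3-element subsets on which the predicate is true
-- (values on subsets of other sizes are irrelevant).

Graph3 : ℕ → Set
Graph3 n = Subset n → Bool

IsEdge : ∀ {n} → Graph3 n → Subset n → Set
IsEdge H S = (∣ S ∣ ≡ 3) × (H S ≡ true)

allSubsets : (n : ℕ) → List (Subset n)
allSubsets zero = [] ∷ []
allSubsets (suc n) = map (true ∷_) (allSubsets n) ++ map (false ∷_) (allSubsets n)

is3 : ∀ {n} → Subset n → Bool
is3 S = ⌊ Data.Nat._≟_ ∣ S ∣ 3 ⌋

numEdges : ∀ {n} → Graph3 n → ℕ
numEdges {n} H = length (filter (λ S → Data.Bool._≟_ (is3 S ∧ H S) true) (allSubsets n))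

image : ∀ {m n} → (Fin m → Fin n) → Subset m → Subset n
image f S = tabulate (λ y → ⌊ any? (λ x → (x ∈? S) ×-dec (f x ≟ y)) ⌋)

_⊂_ : ∀ {m n} → Graph3 m → Graph3 n → Set
_⊂_ {m} {n} F H = Σ (Fin m → Fin n) λ f → Injective _≡_ _≡_ f ×
                    (∀ S → IsEdge F S → IsEdge H (image f S))

mem : ∀ {n} → Fin n → Subset n → Bool
mem x S = ⌊ x ∈? S ⌋

v0 v1 v2 v3 v4 v5 : ∀ {n} → Fin (6 + n)
v0 = f0
v1 = fs f0
v2 = fs (fs f0)
v3 = fs (fs (fs f0))
v4 = fs (fs (fs (fs f0)))
v5 = fs (fs (fs (fs (fs f0))))

hasAll : ∀ {n} → Fin n → Fin n → Fin n → Subset n → Bool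
hasAll a b c S = mem a S ∧ mem b S ∧ mem c S

K5minus : Graph3 5
K5minus S = not (hasAll f0 (fs f0) (fs (fs f0)) S)

IsCore : ∀ {m} → ℕ → Graph3 m → Subset m → Set
IsCore {m} L F S = (∣ S ∣ ≡ L) ×
  (∀ x y → x ∈ S → y ∈ S → x ≢ y → ∃ λ T → IsEdge F T × x ∈ T × y ∈ T)

InK : ∀ {m} → ℕ → Graph3 m → Set
InK {m} L F = (m ≤ L + L C 2) × ∃ λ S → IsCore L F S

IsTransversalInduced : ∀ {m} → Graph3 m → Subset m → Subset m → Set
IsTransversalInduced F S T = (T ⊆ S) ×
  (∀ E → IsEdge F E → E ⊆ S → ∃ λ x → x ∈ E × x ∈ T)

TauInducedGe : ∀ {m} → ℕ → Graph3 m → Subset m → Set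
TauInducedGe k F S = ∀ T → IsTransversalInduced F S T → k ≤ ∣ T ∣

setA : (n : ℕ) → Subset n
setA n = tabulate (λ i → ⌊ Data.Nat._<?_ (toℕ i) (n / 3) ⌋)

G1 : (n : ℕ) → Graph3 n
G1 n S = ⌊ Data.Nat._≟_ ∣ S ∩ setA n ∣ 1 ⌋

-- G^2_6 on Fin 6 (vertex i+1 of the paper is i here): all triples except
-- {1,2,3},{1,2,6},{3,4,5},{4,5,6}
G2six : Graph3 6
G2six S = not (hasAll v0 v1 v2 S) ∧ not (hasAll v0 v1 v5 S)
        ∧ not (hasAll v2 v3 v4 S) ∧ not (hasAll v3 v4 v5 S)

-- blowup of T on s vertices: vertex x of Fin N lies in part p x.
-- Edges: triples whose three vertices lie in three distinct parts
-- forming an edge of T.  Part sizes are t_i = |p⁻¹(i)|, which are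
-- positive iff p is surjective.
blowup : ∀ {s N} → Graph3 s → (Fin N → Fin s) → Graph3 N
blowup T p S = is3 (image p S) ∧ T (image p S)

Surjective' : ∀ {s N} → (Fin N → Fin s) → Set
Surjective' {s} {N} p = ∀ y → ∃ λ x → p x ≡ y

-- p gives a blowup of G^2_6 on n vertices with the maximum number of
-- edges (a possible choice of G^2_n; for n = 6 this is G^2_6 itself)
IsMaxG2Blowup : (n : ℕ) → (Fin n → Fin 6) → Set
IsMaxG2Blowup n p = Surjective' p ×
  (∀ (q : Fin n → Fin 6) → Surjective' q →
     numEdges (blowup G2six q) ≤ numEdges (blowup G2six p))

InM1 : ∀ {m} → Graph3 m → Set
InM1 {m} F = Σ (m ≡ 5) λ { _≡_.refl → ∀ S → IsEdge F S ⇔' IsEdge K5minus S }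
  where
  _⇔'_ : Set → Set → Set
  A ⇔' B = (A → B) × (B → A)

InM2 : ∀ {m} → Graph3 m → Set
InM2 {m} F = (m ≤ 7 + 7 C 2) × ∃ λ S → IsCore 7 F S × TauInducedGe 2 F S

InM3 : ∀ {m} → Graph3 m → Set
InM3 F = InK 6 F
  × (∀ n → 1 ≤ n → ¬ (F ⊂ G1 n))
  × (∀ n → 6 ≤ n → ∀ p → IsMaxG2Blowup n p → ¬ (F ⊂ blowup G2six p))

data InM {m : ℕ} (F : Graph3 m) : Set where
  m1 : InM1 F → InM F
  m2 : InM2 F → InM F
  m3 : InM3 F → InM F

MFree : ∀ {n} → Graph3 n → Set
MFree H = ∀ m (F : Graph3 m) → InM F → ¬ (F ⊂ H)

{-# OPTIONS --safe #-}
module Submission where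

-- Upper bound.  The number of edges of H is the value of a cubic form at the all-ones
-- weighting.  If no edge contains both x and y, the form is linear along shifts of
-- weight between x and y, so one of the two can be deleted without decreasing the
-- value or changing the total weight.  This leaves a weighting of a vertex set U
-- every pair of which lies in an edge inside U.  If |U| ≤ 5, or if |U| = 6 and H[U]
-- embeds in some G²ₙ, then H[U] maps homomorphically to G²₆ (for |U| = 5 because at
-- least two triples are missing).  If |U| = 6 and H[U] embeds in some G¹ₙ, or if
-- |U| ≥ 7, where M₂-freeness makes any seven vertices span a star and a Helly
-- argument makes all of H[U] a star, then every edge of H[U] has exactly one vertex
-- in some set A.  Either way the estimate reduces to 27ab² ≤ 4(a+b)³.
--
-- Lower bound.  The balanced blowup of G²₆ attains 2n³/27, so by the upper bound for
-- blowups it is a possible choice of G²ₙ, and therefore contains no member of M₃.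

open import Defs
open import Data.Bool as 𝔹 using (Bool; true; false; _∧_; if_then_else_)
open import Data.Bool.Properties using (¬-not)
open import Data.Empty using (⊥)
open import Data.Fin using (Fin; zero; suc; toℕ; fromℕ<; inject≤; punchIn; punchOut; splitAt; _↑ˡ_)
open import Data.Fin.Patterns
open import Data.Fin.Properties as Fin using (_≟_; any?; all?; suc-injective; punchIn-injective; punchIn-punchOut; inject≤-injective; injective⇒≤; splitAt-↑ˡ; pigeonhole; <⇒≢)
open import Data.Fin.Subset using (Subset; _∈_; _∉_; _⊆_; ∣_∣; _∩_; _∪_; ⁅_⁆; ⊤) renaming (⊥ to ∅)
open import Data.Fin.Subset.Properties
open import Data.List as List using (List; []; _∷_; length; _++_; map; filter; allFin; cartesianProduct)
open import Data.List.Membership.Propositional using () renaming (_∈_ to _∈ˡ_)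
open import Data.List.Membership.Propositional.Properties using (∈-allFin; ∈-cartesianProduct⁺; ∈-filter⁺; ∈-map⁺; ∈-++⁺ˡ; ∈-++⁺ʳ)
open import Data.List.Properties using (length-++; filter-++)
open import Data.List.Relation.Unary.Any using (here; there)
open import Data.Nat as ℕ using (ℕ; zero; suc; _+_; _*_; _^_; _≤_; _≥_; _<_; z≤n; s≤s)
open import Data.Nat.Divisibility using (_∣_; divides)
import Data.Nat.Properties as ℕ
open import Data.Nat.Solver using (module +-*-Solver)
open import Data.Nat.Tactic.RingSolver using (solve-∀)
open import Data.Product using (Σ; ∃; _×_; _,_; proj₁; proj₂; uncurry)
open import Data.Sum as Sum using (_⊎_; inj₁; inj₂; [_,_]′)
open import Data.Vec using (Vec; []; _∷_; here; there; tabulate; lookup)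
import Data.Vec.Functional as Vector
open import Data.Vec.Properties using (≡-dec; lookup∘tabulate; lookup⇒[]=; []=⇒lookup)
open import Function using (_∘_; id)
open import Function.Definitions using (Injective)
open import Relation.Binary using (tri<; tri≈; tri>)
open import Relation.Binary.PropositionalEquality
open import Relation.Nullary using (¬_; Dec; yes; no; contradiction; ¬?)
open import Relation.Nullary.Decidable using (⌊_⌋; _×-dec_; _⊎-dec_; _→-dec_; from-yes; decidable-stable)
open import Algebra.Properties.Semiring.Sum ℕ.+-*-semiring using (sum; sum-cong-≗; sum-remove; ∑-distrib-+; ∑-comm; *-distribˡ-sum; *-distribʳ-sum; sum-replicate-zero)

private variable
  m n : ℕ

-- Injections, Booleans and decisions

Inj : (Fin m → Fin n) → Set
Inj f = Injective _≡_ _≡_ f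

∧-true⁻ : ∀ {a b} → a ∧ b ≡ true → a ≡ true × b ≡ true
∧-true⁻ {true} {true} _ = refl , refl

∧-true⁺ : ∀ {a b} → a ≡ true → b ≡ true → a ∧ b ≡ true
∧-true⁺ refl refl = refl

⌊⌋-true⁻ : ∀ {A : Set} {d : Dec A} → ⌊ d ⌋ ≡ true → A
⌊⌋-true⁻ {d = yes a} _ = a

⌊⌋-true⁺ : ∀ {A : Set} {d : Dec A} → A → ⌊ d ⌋ ≡ true
⌊⌋-true⁺ {d = yes _} _ = refl
⌊⌋-true⁺ {d = no ¬a} a = contradiction a ¬a

-- Sizes of finite sets

∣⁅x⁆∪p∣ : ∀ {x : Fin n} {p} → x ∉ p → ∣ ⁅ x ⁆ ∪ p ∣ ≡ suc ∣ p ∣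
∣⁅x⁆∪p∣ {x = zero} {true ∷ p} x∉p = contradiction here x∉p
∣⁅x⁆∪p∣ {x = zero} {false ∷ p} x∉p = cong (suc ∘ ∣_∣) (∪-identityˡ p)
∣⁅x⁆∪p∣ {x = suc x} {true ∷ p} x∉p = cong suc (∣⁅x⁆∪p∣ (x∉p ∘ there))
∣⁅x⁆∪p∣ {x = suc x} {false ∷ p} x∉p = ∣⁅x⁆∪p∣ (x∉p ∘ there)

⁅x⁆∪p≡p : ∀ {x : Fin n} {p} → x ∈ p → ⁅ x ⁆ ∪ p ≡ p
⁅x⁆∪p≡p {x = x} {p} x∈p = ⊆-antisym
  (λ z → [ (λ w → subst (_∈ p) (sym (x∈⁅y⁆⇒x≡y x w)) x∈p) , id ]′ (x∈p∪q⁻ ⁅ x ⁆ p z))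
  (q⊆p∪q ⁅ x ⁆ p)

∣⁅x⁆∪p∣≤ : ∀ (x : Fin n) p → ∣ ⁅ x ⁆ ∪ p ∣ ≤ suc ∣ p ∣
∣⁅x⁆∪p∣≤ x p with x ∈? p
... | yes x∈p rewrite ⁅x⁆∪p≡p x∈p = ℕ.n≤1+n _
... | no x∉p = ℕ.≤-reflexive (∣⁅x⁆∪p∣ x∉p)

-- Valued in `Fin 2` rather than `Bool`, so that it can serve as a vertex map into the two-class
-- pattern `exactlyOne`.
χ : Subset n → Fin n → Fin 2
χ A x with x ∈? A
... | yes _ = suc zero
... | no _ = zero

χ-∈ : ∀ {A : Subset n} {x} → x ∈ A → χ A x ≡ suc zero
χ-∈ {A = A} {x} x∈A with x ∈? A
... | yes _ = refl
... | no x∉A = contradiction x∈A x∉A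

χ-∉ : ∀ {A : Subset n} {x} → x ∉ A → χ A x ≡ zero
χ-∉ {A = A} {x} x∉A with x ∈? A
... | yes x∈A = contradiction x∈A x∉A
... | no _ = refl

∣⁅x⁆∪p∩A∣ : ∀ {x : Fin n} {p} A → x ∉ p → ∣ (⁅ x ⁆ ∪ p) ∩ A ∣ ≡ toℕ (χ A x) + ∣ p ∩ A ∣
∣⁅x⁆∪p∩A∣ {x = x} {p} A x∉p with x ∈? A
... | yes x∈A = trans (cong ∣_∣ eq) (∣⁅x⁆∪p∣ (x∉p ∘ proj₁ ∘ x∈p∩q⁻ p A))
  where
  eq : (⁅ x ⁆ ∪ p) ∩ A ≡ ⁅ x ⁆ ∪ (p ∩ A)
  eq = trans (∩-distribʳ-∪ A ⁅ x ⁆ p) (cong (_∪ (p ∩ A)) (⊆-antisym (p∩q⊆p ⁅ x ⁆ A)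
    λ z → x∈p∩q⁺ (z , subst (_∈ A) (sym (x∈⁅y⁆⇒x≡y x z)) x∈A)))
... | no x∉A = cong ∣_∣ (⊆-antisym l r)
  where
  l : (⁅ x ⁆ ∪ p) ∩ A ⊆ p ∩ A
  l z with x∈p∩q⁻ (⁅ x ⁆ ∪ p) A z
  ... | zl , zr with x∈p∪q⁻ ⁅ x ⁆ p zl
  ... | inj₁ z∈x = contradiction (subst (_∈ A) (x∈⁅y⁆⇒x≡y x z∈x) zr) x∉A
  ... | inj₂ z∈p = x∈p∩q⁺ (z∈p , zr)
  r : p ∩ A ⊆ (⁅ x ⁆ ∪ p) ∩ A
  r z with x∈p∩q⁻ p A z
  ... | zl , zr = x∈p∩q⁺ (q⊆p∪q ⁅ x ⁆ p zl , zr)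

fromList : List (Fin n) → Subset n
fromList [] = ∅
fromList (x ∷ xs) = ⁅ x ⁆ ∪ fromList xs

∣fromList∣≤ : (xs : List (Fin n)) → ∣ fromList xs ∣ ≤ length xs
∣fromList∣≤ {n} [] = ℕ.≤-reflexive (∣⊥∣≡0 n)
∣fromList∣≤ (x ∷ xs) = ℕ.≤-trans (∣⁅x⁆∪p∣≤ x (fromList xs)) (s≤s (∣fromList∣≤ xs))

∈-fromList : ∀ {x : Fin n} {xs} → x ∈ˡ xs → x ∈ fromList xs
∈-fromList {xs = x ∷ xs} (here refl) = p⊆p∪q (fromList xs) (x∈⁅x⁆ x)
∈-fromList {xs = y ∷ xs} (there x∈) = q⊆p∪q ⁅ y ⁆ (fromList xs) (∈-fromList x∈)

-- The size `k` is kept apart from `∣ S ∣`, so that an enumeration can be transported along an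
-- equation for the cardinality.
record Enumeration (S : Subset n) (k : ℕ) : Set where
  field
    elem : Fin k → Fin n
    elem-injective : Inj elem
    elem∈ : ∀ i → elem i ∈ S
    index : ∀ {x} → x ∈ S → ∃ λ i → elem i ≡ x

open Enumeration

enumerate : (S : Subset n) → Enumeration S ∣ S ∣
enumerate [] = record { elem = λ () ; elem-injective = λ { {()} } ; elem∈ = λ () ; index = λ () }
enumerate (false ∷ S) = record
  { elem = suc ∘ elem E
  ; elem-injective = elem-injective E ∘ suc-injective
  ; elem∈ = λ i → there (elem∈ E i)
  ; index = λ { (there x∈) → proj₁ (index E x∈) , cong suc (proj₂ (index E x∈)) } }
  where E = enumerate S
enumerate (true ∷ S) = record
  { elem = λ { zero → zero ; (suc i) → suc (elem E i) }
  ; elem-injective = λ { {zero} {zero} _ → refl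
                       ; {suc i} {suc j} eq → cong suc (elem-injective E (suc-injective eq)) }
  ; elem∈ = λ { zero → here ; (suc i) → there (elem∈ E i) }
  ; index = λ { here → zero , refl
              ; (there x∈) → suc (proj₁ (index E x∈)) , cong suc (proj₂ (index E x∈)) } }
  where E = enumerate S

enlarge : ∀ {k} (S : Subset n) → ∣ S ∣ ≤ k → k ≤ n → ∃ λ S′ → S ⊆ S′ × ∣ S′ ∣ ≡ k
enlarge [] _ z≤n = [] , id , refl
enlarge (true ∷ S) (s≤s S≤k) (s≤s k≤n) with enlarge S S≤k k≤n
... | S′ , S⊆S′ , eq = true ∷ S′ , in⊆in S⊆S′ , cong suc eq
enlarge {suc n} {k} (false ∷ S) S≤k k≤1+n with k ℕ.≤? n
... | yes k≤n with S′ , S⊆S′ , eq ← enlarge S S≤k k≤n = false ∷ S′ , s⊆s S⊆S′ , eq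
... | no k≰n = ⊤ , ⊆⊤ , trans (∣⊤∣≡n (suc n)) (ℕ.≤-antisym (ℕ.≰⇒> k≰n) k≤1+n)

-- Images and unordered triples

∈-image⁻ : (f : Fin m → Fin n) (S : Subset m) {y : Fin n} → y ∈ image f S → ∃ λ x → x ∈ S × f x ≡ y
∈-image⁻ f S {y} y∈ = ⌊⌋-true⁻ (trans (sym (lookup∘tabulate _ y)) ([]=⇒lookup y∈))

∈-image⁺ : (f : Fin m → Fin n) (S : Subset m) {x : Fin m} → x ∈ S → f x ∈ image f S
∈-image⁺ f S {x} x∈ = lookup⇒[]= _ _ (trans (lookup∘tabulate _ (f x)) (⌊⌋-true⁺ (x , x∈ , refl)))

triple : Fin n → Fin n → Fin n → Subset n
triple i j k = ⁅ i ⁆ ∪ (⁅ j ⁆ ∪ ⁅ k ⁆)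

infix 4 _∈₃_
_∈₃_ : Fin n → Fin n × Fin n × Fin n → Set
x ∈₃ (i , j , k) = x ≡ i ⊎ x ≡ j ⊎ x ≡ k

∈-triple⁻ : ∀ {x i j k : Fin n} → x ∈ triple i j k → x ∈₃ (i , j , k)
∈-triple⁻ {x = x} {i} {j} {k} x∈ with x∈p∪q⁻ ⁅ i ⁆ _ x∈
... | inj₁ p = inj₁ (x∈⁅y⁆⇒x≡y i p)
... | inj₂ q with x∈p∪q⁻ ⁅ j ⁆ ⁅ k ⁆ q
... | inj₁ p = inj₂ (inj₁ (x∈⁅y⁆⇒x≡y j p))
... | inj₂ p = inj₂ (inj₂ (x∈⁅y⁆⇒x≡y k p))

∈-triple⁺ : ∀ {x i j k : Fin n} → x ∈₃ (i , j , k) → x ∈ triple i j k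
∈-triple⁺ (inj₁ refl) = x∈p∪q⁺ (inj₁ (x∈⁅x⁆ _))
∈-triple⁺ (inj₂ (inj₁ refl)) = x∈p∪q⁺ (inj₂ (x∈p∪q⁺ (inj₁ (x∈⁅x⁆ _))))
∈-triple⁺ {i = i} {j} (inj₂ (inj₂ refl)) = x∈p∪q⁺ {p = ⁅ i ⁆} (inj₂ (x∈p∪q⁺ {p = ⁅ j ⁆} (inj₂ (x∈⁅x⁆ _))))

triple-swap : ∀ (i j k : Fin n) → triple i j k ≡ triple j i k
triple-swap i j k = ⊆-antisym (s i j) (s j i)
  where
  s : ∀ i j → triple i j k ⊆ triple j i k
  s i j x∈ with ∈-triple⁻ x∈
  ... | inj₁ e = ∈-triple⁺ (inj₂ (inj₁ e))
  ... | inj₂ (inj₁ e) = ∈-triple⁺ (inj₁ e)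
  ... | inj₂ (inj₂ e) = ∈-triple⁺ (inj₂ (inj₂ e))

triple-swapʳ : ∀ (i j k : Fin n) → triple i j k ≡ triple i k j
triple-swapʳ i j k = cong (⁅ i ⁆ ∪_) (∪-comm ⁅ j ⁆ ⁅ k ⁆)

image-triple : (f : Fin m → Fin n) → ∀ i j k → image f (triple i j k) ≡ triple (f i) (f j) (f k)
image-triple f i j k = ⊆-antisym l r
  where
  l : image f (triple i j k) ⊆ triple (f i) (f j) (f k)
  l y∈ with ∈-image⁻ f _ y∈
  ... | x , x∈ , refl with ∈-triple⁻ x∈
  ... | inj₁ refl = ∈-triple⁺ (inj₁ refl)
  ... | inj₂ (inj₁ refl) = ∈-triple⁺ (inj₂ (inj₁ refl))
  ... | inj₂ (inj₂ refl) = ∈-triple⁺ (inj₂ (inj₂ refl))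
  r : triple (f i) (f j) (f k) ⊆ image f (triple i j k)
  r y∈ with ∈-triple⁻ y∈
  ... | inj₁ refl = ∈-image⁺ f _ (∈-triple⁺ (inj₁ refl))
  ... | inj₂ (inj₁ refl) = ∈-image⁺ f _ (∈-triple⁺ {i = i} (inj₂ (inj₁ refl)))
  ... | inj₂ (inj₂ refl) = ∈-image⁺ f _ (∈-triple⁺ {i = i} {j} (inj₂ (inj₂ refl)))

Distinct : Fin n → Fin n → Fin n → Set
Distinct i j k = i ≢ j × i ≢ k × j ≢ k

-- A repeated index would collapse the union to at most two elements.
distinct : ∀ {i j k : Fin n} → ∣ triple i j k ∣ ≡ 3 → Distinct i j k
distinct {n} {i} {j} {k} eq = i≢j , i≢k , j≢k
  where
  pair≤2 : ∀ (x y : Fin n) → ¬ (∣ ⁅ x ⁆ ∪ ⁅ y ⁆ ∣ ≡ 3)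
  pair≤2 x y e with ℕ.≤-trans (ℕ.≤-reflexive (sym e)) (subst (λ t → ∣ ⁅ x ⁆ ∪ ⁅ y ⁆ ∣ ≤ suc t) (∣⁅x⁆∣≡1 y) (∣⁅x⁆∪p∣≤ x ⁅ y ⁆))
  ... | s≤s (s≤s ())
  absorb : i ∈ ⁅ j ⁆ ∪ ⁅ k ⁆ → ¬ (∣ triple i j k ∣ ≡ 3)
  absorb i∈ e = pair≤2 j k (trans (cong ∣_∣ (sym (⁅x⁆∪p≡p i∈))) e)
  i≢j : i ≢ j
  i≢j refl = absorb (p⊆p∪q ⁅ k ⁆ (x∈⁅x⁆ i)) eq
  i≢k : i ≢ k
  i≢k refl = absorb (q⊆p∪q ⁅ j ⁆ ⁅ k ⁆ (x∈⁅x⁆ i)) eq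
  j≢k : j ≢ k
  j≢k refl = pair≤2 i j (trans (cong (λ s → ∣ ⁅ i ⁆ ∪ s ∣) (sym (∪-idem ⁅ j ⁆))) eq)

i∉⁅j⁆∪⁅k⁆ : ∀ {i j k : Fin n} → i ≢ j → i ≢ k → i ∉ ⁅ j ⁆ ∪ ⁅ k ⁆
i∉⁅j⁆∪⁅k⁆ {j = j} {k} i≢j i≢k i∈ with x∈p∪q⁻ ⁅ j ⁆ ⁅ k ⁆ i∈
... | inj₁ p = i≢j (x∈⁅y⁆⇒x≡y j p)
... | inj₂ p = i≢k (x∈⁅y⁆⇒x≡y k p)

∣triple∣ : ∀ {i j k : Fin n} → Distinct i j k → ∣ triple i j k ∣ ≡ 3
∣triple∣ {i = i} {j} {k} (i≢j , i≢k , j≢k) = trans (∣⁅x⁆∪p∣ (i∉⁅j⁆∪⁅k⁆ i≢j i≢k))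
  (cong suc (trans (∣⁅x⁆∪p∣ (x≢y⇒x∉⁅y⁆ j≢k)) (cong suc (∣⁅x⁆∣≡1 k))))

∣triple∩A∣ : ∀ {i j k : Fin n} A → Distinct i j k → ∣ triple i j k ∩ A ∣ ≡ toℕ (χ A i) + (toℕ (χ A j) + toℕ (χ A k))
∣triple∩A∣ {n} {i} {j} {k} A (i≢j , i≢k , j≢k) = trans (∣⁅x⁆∪p∩A∣ A (i∉⁅j⁆∪⁅k⁆ i≢j i≢k)) (cong (toℕ (χ A i) +_)
  (trans (∣⁅x⁆∪p∩A∣ A (x≢y⇒x∉⁅y⁆ j≢k)) (cong (toℕ (χ A j) +_) single)))
  where
  single : ∣ ⁅ k ⁆ ∩ A ∣ ≡ toℕ (χ A k)
  single = begin
    ∣ ⁅ k ⁆ ∩ A ∣           ≡⟨ cong (λ s → ∣ s ∩ A ∣) (∪-identityʳ ⁅ k ⁆) ⟨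
    ∣ (⁅ k ⁆ ∪ ∅) ∩ A ∣     ≡⟨ ∣⁅x⁆∪p∩A∣ A ∉⊥ ⟩
    toℕ (χ A k) + ∣ ∅ ∩ A ∣       ≡⟨ cong (λ s → toℕ (χ A k) + ∣ s ∣) (∩-zeroˡ A) ⟩
    toℕ (χ A k) + ∣ ∅ {n} ∣       ≡⟨ cong (toℕ (χ A k) +_) (∣⊥∣≡0 n) ⟩
    toℕ (χ A k) + 0               ≡⟨ ℕ.+-identityʳ _ ⟩
    toℕ (χ A k)                   ∎
    where open ≡-Reasoning

size3⇒triple : (S : Subset n) → ∣ S ∣ ≡ 3 → ∃ λ i → ∃ λ j → ∃ λ k → S ≡ triple i j k
size3⇒triple S eq = e zero , e (suc zero) , e (suc (suc zero)) , ⊆-antisym l r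
  where
  E = subst (Enumeration S) eq (enumerate S)
  e = elem E
  l : S ⊆ triple (e zero) (e (suc zero)) (e (suc (suc zero)))
  l x∈ with index E x∈
  ... | zero , refl = ∈-triple⁺ (inj₁ refl)
  ... | suc zero , refl = ∈-triple⁺ {i = e zero} (inj₂ (inj₁ refl))
  ... | suc (suc zero) , refl = ∈-triple⁺ {i = e zero} {e (suc zero)} (inj₂ (inj₂ refl))
  r : triple (e zero) (e (suc zero)) (e (suc (suc zero))) ⊆ S
  r x∈ with ∈-triple⁻ x∈
  ... | inj₁ refl = elem∈ E zero
  ... | inj₂ (inj₁ refl) = elem∈ E (suc zero)
  ... | inj₂ (inj₂ refl) = elem∈ E (suc (suc zero))

toNat : Bool → ℕ
toNat b = if b then 1 else 0

sum-zero : ∀ {f : Fin n → ℕ} → (∀ i → f i ≡ 0) → sum f ≡ 0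
sum-zero {n} eq = trans (sum-cong-≗ eq) (sum-replicate-zero n)

sum-mono : ∀ {f g : Fin n → ℕ} → (∀ i → f i ≤ g i) → sum f ≤ sum g
sum-mono {zero} _ = z≤n
sum-mono {suc n} le = ℕ.+-mono-≤ (le zero) (sum-mono (le ∘ suc))

-- Counting edges by ordered triples

sumSubsets : (Subset n → ℕ) → ℕ
sumSubsets {zero} φ = φ []
sumSubsets {suc n} φ = sumSubsets (φ ∘ (true ∷_)) + sumSubsets (φ ∘ (false ∷_))

length-filter-map : ∀ {A B : Set} (f : A → B) (P : B → Bool) xs →
  length (filter (λ x → P x 𝔹.≟ true) (map f xs)) ≡ length (filter (λ x → P (f x) 𝔹.≟ true) xs)
length-filter-map f P [] = refl
length-filter-map f P (x ∷ xs) with P (f x) 𝔹.≟ true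
... | yes _ = cong suc (length-filter-map f P xs)
... | no _ = length-filter-map f P xs

length-filter-allSubsets : (P : Subset n → Bool) →
  length (filter (λ S → P S 𝔹.≟ true) (allSubsets n)) ≡ sumSubsets (toNat ∘ P)
length-filter-allSubsets {zero} P with P []
... | true = refl
... | false = refl
length-filter-allSubsets {suc n} P = begin
  length (filter P? (map (true ∷_) Ss ++ map (false ∷_) Ss))
    ≡⟨ cong length (filter-++ P? (map (true ∷_) Ss) _) ⟩
  length (filter P? (map (true ∷_) Ss) ++ filter P? (map (false ∷_) Ss))
    ≡⟨ length-++ (filter P? (map (true ∷_) Ss)) ⟩
  length (filter P? (map (true ∷_) Ss)) + length (filter P? (map (false ∷_) Ss))
    ≡⟨ cong₂ _+_ (part true) (part false) ⟩
  sumSubsets (toNat ∘ P) ∎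
  where
  open ≡-Reasoning
  Ss = allSubsets n
  P? = λ S → P S 𝔹.≟ true
  part : ∀ b → length (filter P? (map (b ∷_) Ss)) ≡ sumSubsets (toNat ∘ P ∘ (b ∷_))
  part b = trans (length-filter-map (b ∷_) P Ss) (length-filter-allSubsets (P ∘ (b ∷_)))

SupportedOn : ℕ → (Subset n → ℕ) → Set
SupportedOn k φ = ∀ S → ∣ S ∣ ≢ k → φ S ≡ 0

tail∈ : ∀ {k} {φ : Subset (suc n) → ℕ} → SupportedOn (suc k) φ → SupportedOn k (φ ∘ (true ∷_))
tail∈ sup S ≢k = sup _ (≢k ∘ ℕ.suc-injective)

tail∉ : ∀ {k} {φ : Subset (suc n) → ℕ} → SupportedOn k φ → SupportedOn k (φ ∘ (false ∷_))
tail∉ sup S = sup _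

sumSubsets-0 : (φ : Subset n → ℕ) → SupportedOn 0 φ → sumSubsets φ ≡ φ ∅
sumSubsets-0 {zero} φ _ = refl
sumSubsets-0 {suc n} φ sup = cong₂ _+_ (vanish (φ ∘ (true ∷_)) λ S → sup _ λ ()) (sumSubsets-0 _ (tail∉ sup))
  where
  vanish : ∀ {m} (ψ : Subset m → ℕ) → (∀ S → ψ S ≡ 0) → sumSubsets ψ ≡ 0
  vanish {zero} ψ z = z []
  vanish {suc m} ψ z = cong₂ _+_ (vanish (ψ ∘ (true ∷_)) (z ∘ (true ∷_))) (vanish (ψ ∘ (false ∷_)) (z ∘ (false ∷_)))

sumSubsets-1 : (φ : Subset n → ℕ) → SupportedOn 1 φ → sumSubsets φ ≡ sum (λ i → φ ⁅ i ⁆)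
sumSubsets-1 {zero} φ sup = sup [] λ ()
sumSubsets-1 {suc n} φ sup = cong₂ _+_ (sumSubsets-0 _ (tail∈ sup)) (sumSubsets-1 _ (tail∉ sup))

-- A 2-set is listed by two ordered pairs, and the diagonal drops out because its unions have one
-- element. The induction splits on whether vertex `zero` occurs.
sumSubsets-2 : (φ : Subset n → ℕ) → SupportedOn 2 φ →
  sum (λ i → sum λ j → φ (⁅ i ⁆ ∪ ⁅ j ⁆)) ≡ 2 * sumSubsets φ
sumSubsets-2 {zero} φ sup = sym (cong (2 *_) (sup [] λ ()))
sumSubsets-2 {suc n} φ sup = begin
  (φ (true ∷ ∅ ∪ ∅) + sum (λ j → φ (true ∷ ∅ ∪ ⁅ j ⁆)))
    + sum (λ i → φ (true ∷ ⁅ i ⁆ ∪ ∅) + sum λ j → φ (false ∷ ⁅ i ⁆ ∪ ⁅ j ⁆))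
    ≡⟨ cong₂ _+_ (cong₂ _+_ diag (sum-cong-≗ λ j → cong (φ ∘ (true ∷_)) (∪-identityˡ ⁅ j ⁆)))
         (trans (∑-distrib-+ {n} _ _) (cong (_+ B) (sum-cong-≗ λ i → cong (φ ∘ (true ∷_)) (∪-identityʳ ⁅ i ⁆)))) ⟩
  A + (A + B)   ≡⟨ cong₂ (λ a b → a + (a + b)) (sym (sumSubsets-1 _ (tail∈ sup))) (sumSubsets-2 _ (tail∉ sup)) ⟩
  S∈ + (S∈ + 2 * S∉)   ≡⟨ arith S∈ S∉ ⟩
  2 * (S∈ + S∉) ∎
  where
  open ≡-Reasoning
  A = sum (λ j → φ (true ∷ ⁅ j ⁆))
  B = sum (λ i → sum λ j → φ (false ∷ ⁅ i ⁆ ∪ ⁅ j ⁆))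
  S∈ = sumSubsets (φ ∘ (true ∷_))
  S∉ = sumSubsets (φ ∘ (false ∷_))
  diag : φ (true ∷ ∅ ∪ ∅) ≡ 0
  diag = sup _ λ e → contradiction (trans (cong ∣_∣ (sym (∪-idem {n} ∅))) (ℕ.suc-injective e)) λ e′ → contradiction (trans (sym (∣⊥∣≡0 n)) e′) λ ()
  arith : ∀ a b → a + (a + 2 * b) ≡ 2 * (a + b)
  arith = solve-∀

sumSubsets-3 : (φ : Subset n → ℕ) → SupportedOn 3 φ →
  sum (λ i → sum λ j → sum λ k → φ (triple i j k)) ≡ 6 * sumSubsets φ
sumSubsets-3 {zero} φ sup = sym (cong (6 *_) (sup [] λ ()))
sumSubsets-3 {suc n} φ sup = begin
  ((φ (true ∷ ∅ ∪ (∅ ∪ ∅)) + sum (λ k → φ (true ∷ ∅ ∪ (∅ ∪ ⁅ k ⁆))))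
    + sum (λ j → φ (true ∷ ∅ ∪ (⁅ j ⁆ ∪ ∅)) + sum λ k → φ (true ∷ ∅ ∪ (⁅ j ⁆ ∪ ⁅ k ⁆))))
  + sum (λ i → (φ (true ∷ ⁅ i ⁆ ∪ (∅ ∪ ∅)) + sum λ k → φ (true ∷ ⁅ i ⁆ ∪ (∅ ∪ ⁅ k ⁆)))
    + sum λ j → φ (true ∷ ⁅ i ⁆ ∪ (⁅ j ⁆ ∪ ∅)) + sum λ k → φ (false ∷ triple i j k))
    ≡⟨ cong₂ _+_ (cong₂ _+_ (cong₂ _+_ (degenerate zero zero zero λ (i≢j , _) → i≢j refl) (sum-zero λ k → degenerate zero zero (suc k) λ (i≢j , _) → i≢j refl))
         (sum-cong-≗ {n} λ j → cong₂ _+_ (degenerate zero (suc j) zero λ (_ , i≢k , _) → i≢k refl) (sum-cong-≗ {n} λ k → cong (φ ∘ (true ∷_)) (∪-identityˡ (⁅ j ⁆ ∪ ⁅ k ⁆)))))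
       (sum-cong-≗ λ i → cong₂ _+_ (cong₂ _+_ (degenerate (suc i) zero zero λ (_ , _ , j≢k) → j≢k refl) (sum-cong-≗ λ k → cong (λ s → φ (true ∷ ⁅ i ⁆ ∪ s)) (∪-identityˡ ⁅ k ⁆)))
         (sum-cong-≗ λ j → cong (λ s → φ (true ∷ ⁅ i ⁆ ∪ s) + sum λ k → φ (false ∷ triple i j k)) (∪-identityʳ ⁅ j ⁆))) ⟩
  A + sum (λ i → A′ i + sum λ j → φ (true ∷ ⁅ i ⁆ ∪ ⁅ j ⁆) + B′ i j)
    ≡⟨ cong (A +_) (trans (∑-distrib-+ {n} _ _) (cong (A +_)
         (trans (sum-cong-≗ {n} λ i → ∑-distrib-+ {n} _ _) (∑-distrib-+ {n} _ _)))) ⟩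
  -- The three copies of `A` come from vertex `zero` standing first, second or third; terms in which
  -- it is repeated have vanished.
  A + (A + (A + B))  ≡⟨ cong₂ (λ a b → a + (a + (a + b))) (sumSubsets-2 _ (tail∈ sup)) (sumSubsets-3 _ (tail∉ sup)) ⟩
  2 * S∈ + (2 * S∈ + (2 * S∈ + 6 * S∉))   ≡⟨ arith S∈ S∉ ⟩
  6 * (S∈ + S∉) ∎
  where
  open ≡-Reasoning
  A′ : Fin n → ℕ
  A′ i = sum λ j → φ (true ∷ ⁅ i ⁆ ∪ ⁅ j ⁆)
  A = sum A′
  B′ : Fin n → Fin n → ℕ
  B′ i j = sum λ k → φ (false ∷ triple i j k)
  B = sum (λ i → sum (B′ i))
  S∈ = sumSubsets (φ ∘ (true ∷_))
  S∉ = sumSubsets (φ ∘ (false ∷_))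
  arith : ∀ a b → 2 * a + (2 * a + (2 * a + 6 * b)) ≡ 6 * (a + b)
  arith = solve-∀
  degenerate : ∀ i j k → ¬ Distinct i j k → φ (triple i j k) ≡ 0
  degenerate i j k ¬d = sup (triple i j k) (¬d ∘ distinct)

-- Edges as a Boolean function of three vertices

edge : Graph3 n → Fin n → Fin n → Fin n → Bool
edge H i j k = is3 (triple i j k) ∧ H (triple i j k)

edge⇒IsEdge : ∀ {H : Graph3 n} {S} → is3 S ∧ H S ≡ true → IsEdge H S
edge⇒IsEdge e with ∧-true⁻ e
... | s , h = ⌊⌋-true⁻ s , h

IsEdge⇒edge : ∀ {H : Graph3 n} {S} → IsEdge H S → is3 S ∧ H S ≡ true
IsEdge⇒edge (s , h) = ∧-true⁺ (⌊⌋-true⁺ s) h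

edge⇒distinct : ∀ (H : Graph3 n) {i j k} → edge H i j k ≡ true → Distinct i j k
edge⇒distinct H e = distinct (proj₁ (edge⇒IsEdge {H = H} e))

edge-swap : ∀ (H : Graph3 n) i j k → edge H i j k ≡ edge H j i k
edge-swap H i j k = cong (λ S → is3 S ∧ H S) (triple-swap i j k)

edge-swapʳ : ∀ (H : Graph3 n) i j k → edge H i j k ≡ edge H i k j
edge-swapʳ H i j k = cong (λ S → is3 S ∧ H S) (triple-swapʳ i j k)

-- Weighted edge counts

infix 8 ⟪_,_⟫
⟪_,_⟫ : (Fin n → ℕ) → (Fin n → ℕ) → ℕ
⟪ w , f ⟫ = sum (λ i → w i * f i)

module _ (w : Fin n → ℕ) where

  ⟪⟫-cong : ∀ {f g} → (∀ i → f i ≡ g i) → ⟪ w , f ⟫ ≡ ⟪ w , g ⟫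
  ⟪⟫-cong eq = sum-cong-≗ {n} λ i → cong (w i *_) (eq i)

  ⟪⟫-mono : ∀ {f g} → (∀ i → f i ≤ g i) → ⟪ w , f ⟫ ≤ ⟪ w , g ⟫
  ⟪⟫-mono le = sum-mono λ i → ℕ.*-monoʳ-≤ (w i) (le i)

  ⟪⟫-zero : ∀ {f} → (∀ i → f i ≡ 0) → ⟪ w , f ⟫ ≡ 0
  ⟪⟫-zero eq = sum-zero λ i → trans (cong (w i *_) (eq i)) (ℕ.*-zeroʳ (w i))

  ⟪⟫-+ : ∀ f g → ⟪ w , (λ i → f i + g i) ⟫ ≡ ⟪ w , f ⟫ + ⟪ w , g ⟫
  ⟪⟫-+ f g = trans (sum-cong-≗ {n} λ i → ℕ.*-distribˡ-+ (w i) (f i) (g i)) (∑-distrib-+ {n} _ _)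

  ⟪⟫-* : ∀ a f → ⟪ w , (λ i → a * f i) ⟫ ≡ a * ⟪ w , f ⟫
  ⟪⟫-* a f = trans (sum-cong-≗ {n} λ i → comm (w i) a (f i)) (sym (*-distribˡ-sum {n} a _))
    where
    comm : ∀ x y z → x * (y * z) ≡ y * (x * z)
    comm = solve-∀

  sum≡⟪w,1⟫ : sum w ≡ ⟪ w , (λ _ → 1) ⟫
  sum≡⟪w,1⟫ = sum-cong-≗ {n} λ i → sym (ℕ.*-identityʳ (w i))

-- For an edge indicator `h` this is six times the Lagrange polynomial of the 3-graph; ordered
-- triples keep it linear in each slot.
form : (Fin n → ℕ) → (Fin n → Fin n → Fin n → ℕ) → ℕ
form w h = ⟪ w , (λ i → ⟪ w , (λ j → ⟪ w , h i j ⟫) ⟫) ⟫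

form-mono : ∀ (w : Fin n → ℕ) {g h} → (∀ i j k → g i j k ≤ h i j k) → form w g ≤ form w h
form-mono w le = ⟪⟫-mono w λ i → ⟪⟫-mono w λ j → ⟪⟫-mono w λ k → le i j k

form-cong : ∀ (w : Fin n → ℕ) {g h} → (∀ i j k → g i j k ≡ h i j k) → form w g ≡ form w h
form-cong w eq = ⟪⟫-cong w λ i → ⟪⟫-cong w λ j → ⟪⟫-cong w λ k → eq i j k

edgeℕ : Graph3 n → Fin n → Fin n → Fin n → ℕ
edgeℕ H i j k = toNat (edge H i j k)

6*numEdges : (H : Graph3 n) → form (λ _ → 1) (edgeℕ H) ≡ 6 * numEdges H
6*numEdges {n} H = begin
  form (λ _ → 1) (edgeℕ H)                          ≡⟨ one (λ i → one λ j → one λ k → refl) ⟩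
  sum (λ i → sum λ j → sum λ k → φ (triple i j k))  ≡⟨ sumSubsets-3 φ supported ⟩
  6 * sumSubsets φ                                  ≡⟨ cong (6 *_) (length-filter-allSubsets (λ S → is3 S ∧ H S)) ⟨
  6 * numEdges H                                    ∎
  where
  open ≡-Reasoning
  φ : Subset n → ℕ
  φ S = toNat (is3 S ∧ H S)
  one : ∀ {f g : Fin n → ℕ} → (∀ i → f i ≡ g i) → ⟪ (λ _ → 1) , f ⟫ ≡ sum g
  one eq = sum-cong-≗ {n} λ i → trans (ℕ.*-identityˡ _) (eq i)
  supported : SupportedOn 3 φ
  supported S ≢3 with is3 S in eq
  ... | true = contradiction (⌊⌋-true⁻ eq) ≢3
  ... | false = refl

δ : Fin n → Fin n → ℕ
δ zero zero = 1
δ zero (suc _) = 0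
δ (suc _) zero = 0
δ (suc i) (suc j) = δ i j

-- Pushing weights forward along a vertex map

sum-δ : ∀ (i : Fin n) (f : Fin n → ℕ) → sum (λ k → δ i k * f k) ≡ f i
sum-δ {suc n} zero f = trans (cong₂ _+_ (ℕ.*-identityˡ (f zero)) (sum-zero {n} λ _ → refl)) (ℕ.+-identityʳ _)
sum-δ (suc i) f = sum-δ i (f ∘ suc)

pushforward : (Fin m → Fin n) → (Fin m → ℕ) → Fin n → ℕ
pushforward f w c = sum (λ i → w i * δ (f i) c)

⟪pushforward⟫ : ∀ (f : Fin m → Fin n) w g → ⟪ pushforward f w , g ⟫ ≡ ⟪ w , g ∘ f ⟫
⟪pushforward⟫ {m} {n} f w g = begin
  sum (λ c → sum (λ i → w i * δ (f i) c) * g c)    ≡⟨ sum-cong-≗ {n} (λ c → *-distribʳ-sum {m} (g c) _) ⟩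
  sum (λ c → sum (λ i → w i * δ (f i) c * g c))    ≡⟨ ∑-comm {n} {m} _ ⟩
  sum (λ i → sum (λ c → w i * δ (f i) c * g c))    ≡⟨ sum-cong-≗ {m} (λ i → trans (sum-cong-≗ {n} λ c → ℕ.*-assoc (w i) (δ (f i) c) (g c))
                                                       (trans (sym (*-distribˡ-sum {n} (w i) _)) (cong (w i *_) (sum-δ (f i) g)))) ⟩
  sum (λ i → w i * g (f i))                        ∎
  where open ≡-Reasoning

form-pushforward : ∀ (f : Fin m → Fin n) w h →
  form (pushforward f w) h ≡ form w (λ i j k → h (f i) (f j) (f k))
form-pushforward f w h = trans (⟪pushforward⟫ f w _) (⟪⟫-cong w λ i →
  trans (⟪pushforward⟫ f w _) (⟪⟫-cong w λ j → ⟪pushforward⟫ f w _))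

sum-pushforward : ∀ (f : Fin m → Fin n) w → sum (pushforward f w) ≡ sum w
sum-pushforward f w = trans (sum≡⟪w,1⟫ (pushforward f w)) (trans (⟪pushforward⟫ f w _) (sym (sum≡⟪w,1⟫ w)))

-- Symmetrisation

-- The two transpositions generate all symmetries, so one vanishing repetition yields the others.
record Is3Graph (h : Fin n → Fin n → Fin n → ℕ) : Set where
  field
    swap : ∀ i j k → h i j k ≡ h j i k
    swapʳ : ∀ i j k → h i j k ≡ h i k j
    irrefl : ∀ i k → h i i k ≡ 0

restrict : (Fin n → Fin n → Fin n → ℕ) → (Fin m → Fin n) → Fin m → Fin m → Fin m → ℕ
restrict h e i j k = h (e i) (e j) (e k)

restrict-is3Graph : ∀ {h} (e : Fin m → Fin n) → Is3Graph h → Is3Graph (restrict h e)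
restrict-is3Graph e G = record
  { swap = λ i j k → swap (e i) (e j) (e k)
  ; swapʳ = λ i j k → swapʳ (e i) (e j) (e k)
  ; irrefl = λ i k → irrefl (e i) (e k) }
  where open Is3Graph G

edgeℕ-is3Graph : (H : Graph3 n) → Is3Graph (edgeℕ H)
edgeℕ-is3Graph H = record
  { swap = λ i j k → cong toNat (edge-swap H i j k)
  ; swapʳ = λ i j k → cong toNat (edge-swapʳ H i j k)
  ; irrefl = irr }
  where
  irr : ∀ i k → edgeℕ H i i k ≡ 0
  irr i k with edge H i i k in eq
  ... | true = contradiction refl (proj₁ (edge⇒distinct H eq))
  ... | false = refl

-- The form is linear in the weight of a single vertex.
form-split : ∀ {h : Fin n → Fin n → Fin n → ℕ} → Is3Graph h → ∀ (w : Fin n → ℕ) (e : Fin m → Fin n) v a z →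
  (∀ f → ⟪ w , f ⟫ ≡ ⟪ v , f ∘ e ⟫ + a * f z) →
  form w h ≡ form v (restrict h e) + 3 * (a * ⟪ v , (λ q → ⟪ v , (λ r → h z (e q) (e r)) ⟫) ⟫)
form-split {h = h} G w e v a z split = begin
  form w h
    ≡⟨ ⟪⟫-cong w Q-eq ⟩
  ⟪ w , (λ p → q₀ p + (2 * a) * ℓ p) ⟫
    ≡⟨ split _ ⟩
  ⟪ v , (λ p → q₀ (e p) + (2 * a) * ℓ (e p)) ⟫ + a * (q₀ z + (2 * a) * ℓ z)
    ≡⟨ cong₂ _+_ (trans (⟪⟫-+ v _ _) (cong (F +_) (trans (⟪⟫-* v (2 * a) _) (cong (2 * a *_) d-eq))))
         (cong (λ t → a * (d + (2 * a) * t)) (⟪⟫-zero v λ r → irrefl z (e r))) ⟩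
  F + (2 * a) * d + a * (d + (2 * a) * 0)
    ≡⟨ arith F a d ⟩
  F + 3 * (a * d) ∎
  where
  open ≡-Reasoning
  open Is3Graph G
  q₀ = λ p → ⟪ v , (λ q → ⟪ v , (λ r → h p (e q) (e r)) ⟫) ⟫
  ℓ = λ p → ⟪ v , (λ r → h p z (e r)) ⟫
  F = form v (restrict h e)
  d = q₀ z
  d-eq : ⟪ v , ℓ ∘ e ⟫ ≡ d
  d-eq = ⟪⟫-cong v λ p → ⟪⟫-cong v λ r → swap (e p) z (e r)
  h-zz : ∀ p → h p z z ≡ 0
  h-zz p = trans (swap p z z) (trans (swapʳ z p z) (irrefl z p))
  arith : ∀ F a d → F + (2 * a) * d + a * (d + (2 * a) * 0) ≡ F + 3 * (a * d)
  arith = solve-∀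
  arith₂ : ∀ a x y → x + a * y + a * (y + a * 0) ≡ x + (2 * a) * y
  arith₂ = solve-∀
  Q-eq : ∀ p → ⟪ w , (λ q → ⟪ w , h p q ⟫) ⟫ ≡ q₀ p + (2 * a) * ℓ p
  Q-eq p = begin
    ⟪ w , (λ q → ⟪ w , h p q ⟫) ⟫
      ≡⟨ ⟪⟫-cong w (λ q → split (h p q)) ⟩
    ⟪ w , (λ q → ⟪ v , h p q ∘ e ⟫ + a * h p q z) ⟫
      ≡⟨ split _ ⟩
    ⟪ v , (λ q → ⟪ v , h p (e q) ∘ e ⟫ + a * h p (e q) z) ⟫ + a * (ℓ p + a * h p z z)
      ≡⟨ cong₂ _+_ (trans (⟪⟫-+ v _ _) (cong (q₀ p +_) (trans (⟪⟫-* v a _) (cong (a *_) (⟪⟫-cong v λ q → swapʳ p (e q) z)))))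
           (cong (λ t → a * (ℓ p + a * t)) (h-zz p)) ⟩
    q₀ p + a * ℓ p + a * (ℓ p + a * 0)
      ≡⟨ arith₂ a (q₀ p) (ℓ p) ⟩
    q₀ p + (2 * a) * ℓ p ∎

-- For symmetric `h`, one third of the partial derivative of the form in the weight of `x`.
link : (Fin n → ℕ) → (Fin n → Fin n → Fin n → ℕ) → Fin n → ℕ
link w h x = ⟪ w , (λ q → ⟪ w , h x q ⟫) ⟫

-- All weight of `i` moves to `j` and `i` is deleted. As no edge contains both, neither link
-- involves the weight `a` of `i`, and the form changes by `3 * a` times the difference of the
-- links.
merge : ∀ {h : Fin (suc m) → Fin (suc m) → Fin (suc m) → ℕ} → Is3Graph h → ∀ {i j} → i ≢ j → (∀ k → h i j k ≡ 0) →
  ∀ w → link w h i ≤ link w h j →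
  ∃ λ v → sum v ≡ sum w × form w h ≤ form v (restrict h (punchIn i))
merge {m} {h} G {i} {j} i≢j uncovered w i≤j = v′ , sums , (begin
  form w h                        ≡⟨ form-split G w π v a i split ⟩
  form v h′ + 3 * (a * link′ i)   ≡⟨ cong (λ t → form v h′ + 3 * (a * t)) (link-eq i (irrefl i)) ⟨
  form v h′ + 3 * (a * link w h i) ≤⟨ ℕ.+-monoʳ-≤ (form v h′) (ℕ.*-monoʳ-≤ 3 (ℕ.*-monoʳ-≤ a i≤j)) ⟩
  form v h′ + 3 * (a * link w h j) ≡⟨ cong (λ t → form v h′ + 3 * (a * t)) (link-eq j λ k → trans (swap j i k) (uncovered k)) ⟩
  form v h′ + 3 * (a * link′ j)   ≡⟨ cong (λ t → form v h′ + 3 * (a * link′ t)) (punchIn-punchOut i≢j) ⟨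
  form v h′ + 3 * (a * link′ (π j′)) ≡⟨ form-split (restrict-is3Graph π G) v′ id v a j′ split′ ⟨
  form v′ h′                      ∎)
  where
  open ℕ.≤-Reasoning
  open Is3Graph G
  π = punchIn i
  j′ = punchOut i≢j
  a = w i
  v = w ∘ π
  v′ = λ k → v k + a * δ j′ k
  h′ = restrict h π
  link′ = λ x → ⟪ v , (λ q → ⟪ v , (λ r → h x (π q) (π r)) ⟫) ⟫
  split : ∀ f → ⟪ w , f ⟫ ≡ ⟪ v , f ∘ π ⟫ + a * f i
  split f = trans (sum-remove {m} {i} (λ k → w k * f k)) (ℕ.+-comm (a * f i) _)
  split′ : ∀ f → ⟪ v′ , f ⟫ ≡ ⟪ v , f ⟫ + a * f j′
  split′ f = trans (sum-cong-≗ {m} λ k → arith (v k) a (δ j′ k) (f k)) (trans (∑-distrib-+ {m} _ _)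
    (cong (⟪ v , f ⟫ +_) (trans (sym (*-distribˡ-sum {m} a _)) (cong (a *_) (sum-δ j′ f)))))
    where
    arith : ∀ x a y z → (x + a * y) * z ≡ x * z + a * (y * z)
    arith = solve-∀
  sums : sum v′ ≡ sum w
  sums = trans (sum≡⟪w,1⟫ v′) (trans (split′ (λ _ → 1)) (trans (sym (split (λ _ → 1))) (sym (sum≡⟪w,1⟫ w))))
  link-eq : ∀ x → (∀ k → h x i k ≡ 0) → link w h x ≡ link′ x
  link-eq x z = trans (split λ q → ⟪ w , h x q ⟫) (trans (cong₂ _+_ (⟪⟫-cong v inner) (cong (a *_) (⟪⟫-zero w z)))
    (trans (cong (link′ x +_) (ℕ.*-zeroʳ a)) (ℕ.+-identityʳ _)))
    where
    inner : ∀ q → ⟪ w , h x (π q) ⟫ ≡ ⟪ v , h x (π q) ∘ π ⟫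
    inner q = trans (split (h x (π q))) (trans (cong (λ t → ⟪ v , h x (π q) ∘ π ⟫ + a * t) (trans (swapʳ x (π q) i) (z (π q))))
      (trans (cong (⟪ v , h x (π q) ∘ π ⟫ +_) (ℕ.*-zeroʳ a)) (ℕ.+-identityʳ _)))

-- The third vertex `e k` is itself among the chosen ones, so the covering takes place inside the
-- induced subgraph.
Covered : Graph3 n → (Fin m → Fin n) → Set
Covered H e = ∀ i j → i ≢ j → ∃ λ k → edge H (e i) (e j) (e k) ≡ true

record CoveredWeighting (H : Graph3 n) (total value : ℕ) : Set where
  field
    size : ℕ
    vertex : Fin size → Fin n
    vertex-injective : Inj vertex
    weight : Fin size → ℕ
    covered : Covered H vertex
    sum-weight : sum weight ≡ total
    value≤ : value ≤ form weight (restrict (edgeℕ H) vertex)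

UncoveredPair : Graph3 n → (Fin m → Fin n) → Set
UncoveredPair H e = ∃ λ i → ∃ λ j → i ≢ j × (∀ k → edge H (e i) (e j) (e k) ≡ false)

covered? : (H : Graph3 n) (e : Fin m → Fin n) → Covered H e ⊎ UncoveredPair H e
covered? H e = decide (any? λ i → any? λ j → ¬? (i ≟ j) ×-dec all? λ k → edge H (e i) (e j) (e k) 𝔹.≟ false)
  where
  decide : Dec (UncoveredPair H e) → Covered H e ⊎ UncoveredPair H e
  decide (yes p) = inj₂ p
  decide (no ¬p) = inj₁ λ i j i≢j → find i j i≢j (any? λ k → edge H (e i) (e j) (e k) 𝔹.≟ true)
    where
    find : ∀ i j → i ≢ j → Dec (∃ λ k → edge H (e i) (e j) (e k) ≡ true) → ∃ λ k → edge H (e i) (e j) (e k) ≡ true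
    find i j i≢j (yes k) = k
    find i j i≢j (no ¬k) = contradiction (i , j , i≢j , λ k → ¬-not λ eq → ¬k (k , eq)) ¬p

abstract
  -- Of the two uncovered vertices, the one with the smaller link is deleted.
  mergeEither : ∀ (h : Fin (suc m) → Fin (suc m) → Fin (suc m) → ℕ) → Is3Graph h → ∀ {i j} → i ≢ j → (∀ k → h i j k ≡ 0) →
    ∀ w → ∃ λ x → ∃ λ v → sum v ≡ sum w × form w h ≤ form v (restrict h (punchIn x))
  mergeEither h G {i} {j} i≢j uncovered w =
    [ (λ le → i , merge G i≢j uncovered w le)
    , (λ le → j , merge G (i≢j ∘ sym) (λ k → trans (Is3Graph.swap G j i k) (uncovered k)) w le)
    ]′ (ℕ.≤-total (link w h i) (link w h j))

relax : ∀ {H : Graph3 n} {total total′ value value′} → total ≡ total′ → value′ ≤ value →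
  CoveredWeighting H total value → CoveredWeighting H total′ value′
relax refl le W = record { CoveredWeighting W ; value≤ = ℕ.≤-trans le (CoveredWeighting.value≤ W) }

-- Each merge removes one vertex, so recursion on `m` ends at a set without uncovered pairs.
symmetrise : ∀ m (H : Graph3 n) (e : Fin m → Fin n) → Inj e → (w : Fin m → ℕ) →
  CoveredWeighting H (sum w) (form w (restrict (edgeℕ H) e))
symmetriseUncovered : ∀ m (H : Graph3 n) (e : Fin m → Fin n) → Inj e → (w : Fin m → ℕ) →
  Covered H e ⊎ UncoveredPair H e → CoveredWeighting H (sum w) (form w (restrict (edgeℕ H) e))

symmetrise m H e e-inj w = symmetriseUncovered m H e e-inj w (covered? H e)

symmetriseUncovered m H e e-inj w (inj₁ cov) = record
  { vertex = e ; vertex-injective = e-inj ; weight = w ; covered = cov ; sum-weight = refl ; value≤ = ℕ.≤-refl }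
symmetriseUncovered (suc m) H e e-inj w (inj₂ (i , j , i≢j , uncovered))
  with mergeEither (restrict (edgeℕ H) e) (restrict-is3Graph e (edgeℕ-is3Graph H)) i≢j (λ k → cong toNat (uncovered k)) w
... | x , v , sums , le = relax sums le (symmetrise m H (e ∘ punchIn x) (λ eq → punchIn-injective x _ _ (e-inj eq)) v)

-- Two inequalities between means

≤-witness : ∀ {a b} → a ≤ b → ∃ λ d → b ≡ a + d
≤-witness {a} {b} le = b ℕ.∸ a , sym (ℕ.m+[n∸m]≡n le)

4xy≤[x+y]² : ∀ x y → 4 * (x * y) ≤ (x + y) * (x + y)
4xy≤[x+y]² x y with ℕ.≤-total x y
... | inj₁ le with d , refl ← ≤-witness le = subst (4 * (x * (x + d)) ≤_) (sym (identity x d)) (ℕ.m≤m+n _ (d * d))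
  where
  identity : ∀ x d → (x + (x + d)) * (x + (x + d)) ≡ 4 * (x * (x + d)) + d * d
  identity = solve-∀
... | inj₂ le with d , refl ← ≤-witness le = subst (4 * ((y + d) * y) ≤_) (sym (identity y d)) (ℕ.m≤m+n _ (d * d))
  where
  identity : ∀ y d → (y + d + y) * (y + d + y) ≡ 4 * ((y + d) * y) + d * d
  identity = solve-∀

-- The inequality of means for `a`, `b / 2`, `b / 2`. The gap is `(b - 2a)² (a + 4b)`; the case
-- split and the witness `d` avoid subtraction.
27ab²≤4[a+b]³ : ∀ a b → 27 * (a * (b * b)) ≤ 4 * (a + b) ^ 3
27ab²≤4[a+b]³ a b with ℕ.≤-total (2 * a) b
... | inj₁ le with d , refl ← ≤-witness le =
  subst (27 * (a * ((2 * a + d) * (2 * a + d))) ≤_) (sym (identity a d)) (ℕ.m≤m+n _ _)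
  where
  identity : ∀ a d → 4 * ((a + (2 * a + d)) * ((a + (2 * a + d)) * ((a + (2 * a + d)) * 1))) ≡ 27 * (a * ((2 * a + d) * (2 * a + d))) + d * d * (9 * a + 4 * d)
  identity = solve-∀
-- The factor `8` makes `a` occur only as `2 * a`, which is then replaced by `b + d` without
-- halving.
... | inj₂ le with d , 2a≡b+d ← ≤-witness le = ℕ.*-cancelˡ-≤ 8 (begin
  8 * (27 * (a * (b * b)))    ≡⟨ left a b ⟩
  108 * (2 * a * (b * b))     ≡⟨ cong (λ t → 108 * (t * (b * b))) 2a≡b+d ⟩
  108 * ((b + d) * (b * b))   ≤⟨ ℕ.m≤m+n _ _ ⟩
  108 * ((b + d) * (b * b)) + d * d * (36 * b + 4 * d)  ≡⟨ middle b d ⟨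
  4 * (b + d + 2 * b) ^ 3     ≡⟨ cong (λ t → 4 * (t + 2 * b) ^ 3) 2a≡b+d ⟨
  4 * (2 * a + 2 * b) ^ 3     ≡⟨ right a b ⟩
  8 * (4 * (a + b) ^ 3)       ∎)
  where
  open ℕ.≤-Reasoning
  left : ∀ a b → 8 * (27 * (a * (b * b))) ≡ 108 * (2 * a * (b * b))
  left = solve-∀
  middle : ∀ b d → 4 * ((b + d + 2 * b) * ((b + d + 2 * b) * ((b + d + 2 * b) * 1))) ≡ 108 * ((b + d) * (b * b)) + d * d * (36 * b + 4 * d)
  middle = solve-∀
  right : ∀ a b → 4 * ((2 * a + 2 * b) * ((2 * a + 2 * b) * ((2 * a + 2 * b) * 1))) ≡ 8 * (4 * ((a + b) * ((a + b) * ((a + b) * 1))))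
  right = solve-∀

-- The form on G²₆ and on the two-class pattern

module Polynomials {n : ℕ} where
  open +-*-Solver public

  ∑ₚ : ∀ {m} → (Fin m → Polynomial n) → Polynomial n
  ∑ₚ = Vector.foldr _:+_ (con 0)

  -- Mirrors the unfolding of `form`, so that its value at `tabulate w` is `form w h` by computation
  -- and the ring solver can treat the whole sum.
  formₚ : (Fin n → Fin n → Fin n → ℕ) → Polynomial n
  formₚ h = ∑ₚ λ i → var i :* ∑ₚ λ j → var j :* ∑ₚ λ k → var k :* con (h i j k)

-- The vertices split into the pairs `v0 v1`, `v3 v4` and `v2 v5`. The only non-edges consist of one
-- of the first two pairs and a vertex of the third.
G26-form : ∀ (w : Fin 6 → ℕ) → let x = w v0 + w v1; y = w v3 + w v4; z = w v2 + w v5 in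
  form w (edgeℕ G2six) ≡
    6 * (x * (y * z) + w v0 * w v1 * y + w v3 * w v4 * x + w v2 * w v5 * (x + y))
G26-form w = prove (tabulate w) (formₚ (edgeℕ G2six))
  (con 6 :* (x :* (y :* z) :+ var v0 :* var v1 :* y :+ var v3 :* var v4 :* x :+ var v2 :* var v5 :* (x :+ y))) refl
  where
  open Polynomials
  x y z : Polynomial 6
  x = var v0 :+ var v1
  y = var v3 :+ var v4
  z = var v2 :+ var v5

-- Summing weights over fibres only regroups terms, and each edge term is matched by an edge term of
-- the same weight; `f` may identify vertices.
form-homomorphism : ∀ (f : Fin m → Fin n) {g : Fin m → Fin m → Fin m → Bool} {h : Fin n → Fin n → Fin n → Bool} →
  (∀ i j k → g i j k ≡ true → h (f i) (f j) (f k) ≡ true) → ∀ w →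
  form w (λ i j k → toNat (g i j k)) ≤ form (pushforward f w) (λ i j k → toNat (h i j k))
form-homomorphism f {g} {h} hom w =
  ℕ.≤-trans (form-mono w λ i j k → mono (hom i j k)) (ℕ.≤-reflexive (sym (form-pushforward f w _)))
  where
  mono : ∀ {a b} → (a ≡ true → b ≡ true) → toNat a ≤ toNat b
  mono {false} _ = z≤n
  mono {true} imp rewrite imp refl = ℕ.≤-refl

-- The products within the three pairs, then `x * y`, are bounded by squares of half sums. With
-- `s = x + y` a multiple of `s * (s + 2 * z)²` remains, and the two quantities `s` and `s + 2 * z`
-- add up to `2 * sum w`. The factor `16` clears denominators.
G26-bound : ∀ (w : Fin 6 → ℕ) → 27 * form w (edgeℕ G2six) ≤ 12 * sum w ^ 3
G26-bound w = ℕ.*-cancelˡ-≤ 16 (begin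
  16 * (27 * form w (edgeℕ G2six))
    ≡⟨ cong (λ t → 16 * (27 * t)) (G26-form w) ⟩
  16 * (27 * (6 * (x * (y * z) + w v0 * w v1 * y + w v3 * w v4 * x + w v2 * w v5 * (x + y))))
    ≡⟨ step₁ x y z (w v0 * w v1) (w v3 * w v4) (w v2 * w v5) ⟩
  162 * (16 * (x * (y * z)) + 4 * (4 * (w v0 * w v1)) * y + 4 * (4 * (w v3 * w v4)) * x + 4 * (4 * (w v2 * w v5)) * (x + y))
    ≤⟨ ℕ.*-monoʳ-≤ 162 (ℕ.+-mono-≤ (ℕ.+-mono-≤ (ℕ.+-monoʳ-≤ (16 * (x * (y * z)))
         (ℕ.*-monoˡ-≤ y (ℕ.*-monoʳ-≤ 4 (4xy≤[x+y]² (w v0) (w v1)))))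
         (ℕ.*-monoˡ-≤ x (ℕ.*-monoʳ-≤ 4 (4xy≤[x+y]² (w v3) (w v4)))))
         (ℕ.*-monoˡ-≤ (x + y) (ℕ.*-monoʳ-≤ 4 (4xy≤[x+y]² (w v2) (w v5))))) ⟩
  162 * (16 * (x * (y * z)) + 4 * (x * x) * y + 4 * (y * y) * x + 4 * (z * z) * (x + y))
    ≡⟨ step₂ x y z ⟩
  162 * ((4 * (x * y)) * (4 * z + (x + y)) + 4 * (z * z) * (x + y))
    ≤⟨ ℕ.*-monoʳ-≤ 162 (ℕ.+-monoˡ-≤ (4 * (z * z) * (x + y)) (ℕ.*-monoˡ-≤ (4 * z + (x + y)) (4xy≤[x+y]² x y))) ⟩
  162 * (((x + y) * (x + y)) * (4 * z + (x + y)) + 4 * (z * z) * (x + y))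
    ≡⟨ step₃ (x + y) z ⟩
  6 * (27 * ((x + y) * ((x + y + 2 * z) * (x + y + 2 * z))))
    ≤⟨ ℕ.*-monoʳ-≤ 6 (27ab²≤4[a+b]³ (x + y) (x + y + 2 * z)) ⟩
  6 * (4 * (x + y + (x + y + 2 * z)) ^ 3)
    ≡⟨ step₄ (w v0) (w v1) (w v2) (w v3) (w v4) (w v5) ⟩
  16 * (12 * sum w ^ 3) ∎)
  where
  open ℕ.≤-Reasoning
  x = w v0 + w v1
  y = w v3 + w v4
  z = w v2 + w v5
  step₁ : ∀ x y z a b c → 16 * (27 * (6 * (x * (y * z) + a * y + b * x + c * (x + y)))) ≡
    162 * (16 * (x * (y * z)) + 4 * (4 * a) * y + 4 * (4 * b) * x + 4 * (4 * c) * (x + y))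
  step₁ = solve-∀
  step₂ : ∀ x y z → 162 * (16 * (x * (y * z)) + 4 * (x * x) * y + 4 * (y * y) * x + 4 * (z * z) * (x + y)) ≡
    162 * ((4 * (x * y)) * (4 * z + (x + y)) + 4 * (z * z) * (x + y))
  step₂ = solve-∀
  step₃ : ∀ s z → 162 * ((s * s) * (4 * z + s) + 4 * (z * z) * s) ≡ 6 * (27 * (s * ((s + 2 * z) * (s + 2 * z))))
  step₃ = solve-∀
  double : ∀ a b c d e f → a + b + (d + e) + (a + b + (d + e) + 2 * (c + f)) ≡ 2 * (a + (b + (c + (d + (e + (f + 0))))))
  double = solve-∀
  scale : ∀ t → 6 * (4 * (2 * t * (2 * t * (2 * t * 1)))) ≡ 16 * (12 * (t * (t * (t * 1))))
  scale = solve-∀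
  step₄ : ∀ a b c d e f → 6 * (4 * (a + b + (d + e) + (a + b + (d + e) + 2 * (c + f))) ^ 3) ≡
    16 * (12 * (a + (b + (c + (d + (e + (f + 0)))))) ^ 3)
  step₄ a b c d e f = trans (cong (λ t → 6 * (4 * t ^ 3)) (double a b c d e f)) (scale (a + (b + (c + (d + (e + (f + 0)))))))

-- The pattern of `G1`, with `1F` for `A` and `0F` for `B`. An edge may use `0F` twice, so this is
-- not a 3-graph on two vertices.
exactlyOne : Fin 2 → Fin 2 → Fin 2 → Bool
exactlyOne a b c = ⌊ toℕ a + (toℕ b + toℕ c) ℕ.≟ 1 ⌋

exactlyOne-bound : ∀ (w : Fin 2 → ℕ) → 27 * form w (λ a b c → toNat (exactlyOne a b c)) ≤ 12 * sum w ^ 3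
exactlyOne-bound w = begin
  27 * form w (λ a b c → toNat (exactlyOne a b c))
    ≡⟨ cong (27 *_) (prove (tabulate w) (formₚ λ a b c → toNat (exactlyOne a b c)) (con 3 :* (var 1F :* (var 0F :* var 0F))) refl) ⟩
  27 * (3 * (w 1F * (w 0F * w 0F)))    ≡⟨ left (w 1F * (w 0F * w 0F)) ⟩
  3 * (27 * (w 1F * (w 0F * w 0F)))    ≤⟨ ℕ.*-monoʳ-≤ 3 (27ab²≤4[a+b]³ (w 1F) (w 0F)) ⟩
  3 * (4 * (w 1F + w 0F) ^ 3)          ≡⟨ right ((w 1F + w 0F) ^ 3) ⟩
  12 * (w 1F + w 0F) ^ 3               ≡⟨ cong (λ t → 12 * t ^ 3) (total (w 0F) (w 1F)) ⟩
  12 * sum w ^ 3                       ∎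
  where
  open ℕ.≤-Reasoning
  open Polynomials
  left : ∀ t → 27 * (3 * t) ≡ 3 * (27 * t)
  left = solve-∀
  right : ∀ t → 3 * (4 * t) ≡ 12 * t
  right = solve-∀
  total : ∀ a b → b + a ≡ a + (b + 0)
  total = solve-∀

module _ (w : Fin m → ℕ) {h : Fin m → Fin m → Fin m → Bool} where

  G26-hom-bound : (f : Fin m → Fin 6) → (∀ i j k → h i j k ≡ true → edge G2six (f i) (f j) (f k) ≡ true) →
    27 * form w (λ i j k → toNat (h i j k)) ≤ 12 * sum w ^ 3
  G26-hom-bound f hom = ℕ.≤-trans (ℕ.*-monoʳ-≤ 27 (form-homomorphism f {h = edge G2six} hom w))
    (subst (λ t → 27 * form (pushforward f w) (edgeℕ G2six) ≤ 12 * t ^ 3) (sum-pushforward f w) (G26-bound (pushforward f w)))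

  exactlyOne-hom-bound : (f : Fin m → Fin 2) → (∀ i j k → h i j k ≡ true → toℕ (f i) + (toℕ (f j) + toℕ (f k)) ≡ 1) →
    27 * form w (λ i j k → toNat (h i j k)) ≤ 12 * sum w ^ 3
  exactlyOne-hom-bound f hom = ℕ.≤-trans (ℕ.*-monoʳ-≤ 27 (form-homomorphism f {h = exactlyOne} (λ i j k e → ⌊⌋-true⁺ (hom i j k e)) w))
    (subst (λ t → 27 * form (pushforward f w) (λ a b c → toNat (exactlyOne a b c)) ≤ 12 * t ^ 3) (sum-pushforward f w) (exactlyOne-bound (pushforward f w)))

-- Induced subgraphs

induced : Graph3 n → (Fin m → Fin n) → Graph3 m
induced H e S = H (image e S)

module _ (H : Graph3 n) {e : Fin m → Fin n} where

  edge-induced⁺ : ∀ {i j k} → edge H (e i) (e j) (e k) ≡ true → edge (induced H e) i j k ≡ true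
  edge-induced⁺ {i} {j} {k} eq = IsEdge⇒edge {H = induced H e}
    ( ∣triple∣ (proj₁ d ∘ cong e , proj₁ (proj₂ d) ∘ cong e , proj₂ (proj₂ d) ∘ cong e)
    , trans (cong H (image-triple e i j k)) (proj₂ (edge⇒IsEdge {H = H} eq)))
    where d = edge⇒distinct H eq

  edge-induced⁻ : Inj e → ∀ {i j k} → edge (induced H e) i j k ≡ true → edge H (e i) (e j) (e k) ≡ true
  edge-induced⁻ e-inj {i} {j} {k} eq = IsEdge⇒edge {H = H}
    ( ∣triple∣ (proj₁ d ∘ e-inj , proj₁ (proj₂ d) ∘ e-inj , proj₂ (proj₂ d) ∘ e-inj)
    , trans (cong H (sym (image-triple e i j k))) (proj₂ (edge⇒IsEdge {H = induced H e} eq)))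
    where d = edge⇒distinct (induced H e) eq

embedding : ∀ (F : Graph3 m) (H : Graph3 n) {e} → Inj e →
  (∀ i j k → edge F i j k ≡ true → edge H (e i) (e j) (e k) ≡ true) → F ⊂ H
embedding F H {e} e-inj hom = e , e-inj , λ S S-edge →
  let i , j , k , eq = size3⇒triple S (proj₁ S-edge) in
  subst (λ S → IsEdge F S → IsEdge H (image e S)) (sym eq)
    (λ s → subst (IsEdge H) (sym (image-triple e i j k)) (edge⇒IsEdge {H = H} (hom i j k (IsEdge⇒edge {H = F} s)))) S-edge

⊂⇒edge : ∀ (F : Graph3 m) (H : Graph3 n) ((e , _) : F ⊂ H) →
  ∀ {i j k} → edge F i j k ≡ true → edge H (e i) (e j) (e k) ≡ true
⊂⇒edge F H (e , _ , pres) {i} {j} {k} eq = IsEdge⇒edge {H = H}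
  (subst (IsEdge H) (image-triple e i j k) (pres _ (edge⇒IsEdge {H = F} eq)))

induced⊂ : ∀ (H : Graph3 n) {e : Fin m → Fin n} → Inj e → induced H e ⊂ H
induced⊂ H {e} e-inj = embedding (induced H e) H e-inj λ i j k → edge-induced⁻ H e-inj

∣image⊤∣ : (f : Fin m → Fin n) → Inj f → ∣ image f ⊤ ∣ ≡ m
∣image⊤∣ {m} f f-inj = ℕ.≤-antisym (injective⇒≤ {f = back} back-inj) (injective⇒≤ {f = forth} forth-inj)
  where
  E = enumerate (image f ⊤)
  pre : ∀ i → ∃ λ x → x ∈ ⊤ × f x ≡ elem E i
  pre i = ∈-image⁻ f ⊤ (elem∈ E i)
  back : Fin ∣ image f ⊤ ∣ → Fin m
  back i = proj₁ (pre i)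
  back-inj : Inj back
  back-inj {i} {j} eq = elem-injective E (trans (sym (proj₂ (proj₂ (pre i)))) (trans (cong f eq) (proj₂ (proj₂ (pre j)))))
  idx : ∀ x → ∃ λ i → elem E i ≡ f x
  idx x = index E (∈-image⁺ f ⊤ ∈⊤)
  forth : Fin m → Fin ∣ image f ⊤ ∣
  forth x = proj₁ (idx x)
  forth-inj : Inj forth
  forth-inj {x} {y} eq = f-inj (trans (sym (proj₂ (idx x))) (trans (cong (elem E) eq) (proj₂ (idx y))))

-- Deciding statements about all triples

distinct? : (i j k : Fin n) → Dec (Distinct i j k)
distinct? i j k = ¬? (i ≟ j) ×-dec ¬? (i ≟ k) ×-dec ¬? (j ≟ k)

infix 4 _∈₃?_
_∈₃?_ : ∀ (x : Fin n) t → Dec (x ∈₃ t)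
x ∈₃? (i , j , k) = x ≟ i ⊎-dec x ≟ j ⊎-dec x ≟ k

_≟ˢ_ : (S T : Subset n) → Dec (S ≡ T)
_≟ˢ_ = ≡-dec 𝔹._≟_

all₃? : {P : Fin n → Fin n → Fin n → Set} → (∀ i j k → Dec (P i j k)) → Dec (∀ i j k → P i j k)
all₃? P? = all? λ i → all? λ j → all? λ k → P? i j k

Counterexample : (P Q : Fin n → Fin n → Fin n → Set) → Set
Counterexample P Q = ∃ λ i → ∃ λ j → ∃ λ k → P i j k × ¬ Q i j k

all₃-or-counterexample : {P Q : Fin n → Fin n → Fin n → Set} →
  (∀ i j k → Dec (P i j k)) → (∀ i j k → Dec (Q i j k)) → (∀ i j k → P i j k → Q i j k) ⊎ Counterexample P Q
all₃-or-counterexample P? Q? with any? (λ i → any? λ j → any? λ k → P? i j k ×-dec ¬? (Q? i j k))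
... | yes ce = inj₂ ce
... | no ¬ce = inj₁ λ i j k p → decidable-stable (Q? i j k) λ ¬q → ¬ce (i , j , k , p , ¬q)

-- At most five vertices

Bound : (H : Graph3 n) (e : Fin m → Fin n) (w : Fin m → ℕ) → Set
Bound H e w = 27 * form w (restrict (edgeℕ H) e) ≤ 12 * sum w ^ 3

-- The pairs `v0 v1` and `v3 v4` together span a complete 3-graph, hence a target for every 3-graph
-- on at most four vertices.
K4⊂G26 : Vec (Fin 6) 4
K4⊂G26 = v0 ∷ v1 ∷ v3 ∷ v4 ∷ []

K4-complete : ∀ i j k → Distinct i j k → edge G2six (lookup K4⊂G26 i) (lookup K4⊂G26 j) (lookup K4⊂G26 k) ≡ true
K4-complete = from-yes (all₃? λ i j k → distinct? i j k →-dec (edge G2six (lookup K4⊂G26 i) (lookup K4⊂G26 j) (lookup K4⊂G26 k) 𝔹.≟ true))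

bound≤4 : (H : Graph3 n) (e : Fin m → Fin n) (w : Fin m → ℕ) → m ≤ 4 → Bound H e w
bound≤4 H e w m≤4 = G26-hom-bound w (λ i → lookup K4⊂G26 (inject≤ i m≤4)) λ i j k eq →
  let (i≢j , i≢k , j≢k) = edge⇒distinct H eq
      inj : ∀ {x y} → e x ≢ e y → inject≤ x m≤4 ≢ inject≤ y m≤4
      inj ne = λ eq → ne (cong e (inject≤-injective m≤4 m≤4 _ _ eq))
  in K4-complete _ _ _ (inj i≢j , inj i≢k , inj j≢k)

-- Moves a missing triple to 0, 1, 2, the triple that `K5minus` lacks. Surjectivity gives the
-- inverse that carries a homomorphism back.
record Relabelling (a b c : Fin 5) : Set where
  field
    σ : Fin 5 → Fin 5
    σ-inj : Inj σ
    σ-surj : ∀ x → ∃ λ y → σ y ≡ x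
    σ0≡a : σ 0F ≡ a
    σ1≡b : σ 1F ≡ b
    σ2≡c : σ 2F ≡ c

extendToPermutation : ∀ (a b c : Fin 5) → Distinct a b c → ∃ λ d → ∃ λ e → let σ = lookup (a ∷ b ∷ c ∷ d ∷ e ∷ []) in
  (∀ x y → σ x ≡ σ y → x ≡ y) × (∀ x → ∃ λ y → σ y ≡ x)
extendToPermutation = from-yes (all₃? {5} λ a b c → distinct? a b c →-dec any? λ d → any? λ e →
  let σ = lookup (a ∷ b ∷ c ∷ d ∷ e ∷ []) in
  all? (λ x → all? λ y → (σ x ≟ σ y) →-dec (x ≟ y)) ×-dec all? (λ x → any? λ y → σ y ≟ x))

relabel : ∀ a b c → Distinct a b c → Relabelling a b c
relabel a b c d = let p , q , inj , surj = extendToPermutation a b c d in record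
  { σ = lookup (a ∷ b ∷ c ∷ p ∷ q ∷ []) ; σ-inj = inj _ _ ; σ-surj = surj ; σ0≡a = refl ; σ1≡b = refl ; σ2≡c = refl }

-- For each triple T ≠ {0,1,2}, an injection Fin 5 → Fin 6 under which every
-- triple other than {0,1,2} and T becomes an edge of G²₆.
secondMissing : Vec ((Fin 5 × Fin 5 × Fin 5) × Vec (Fin 6) 5) 9
secondMissing =
    ((0F , 1F , 3F) , 3F ∷ 4F ∷ 2F ∷ 5F ∷ 1F ∷ [])
  ∷ ((0F , 1F , 4F) , 3F ∷ 4F ∷ 2F ∷ 1F ∷ 5F ∷ [])
  ∷ ((0F , 2F , 3F) , 3F ∷ 2F ∷ 4F ∷ 5F ∷ 1F ∷ [])
  ∷ ((0F , 2F , 4F) , 3F ∷ 2F ∷ 4F ∷ 1F ∷ 5F ∷ [])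
  ∷ ((1F , 2F , 3F) , 2F ∷ 3F ∷ 4F ∷ 5F ∷ 1F ∷ [])
  ∷ ((1F , 2F , 4F) , 2F ∷ 3F ∷ 4F ∷ 1F ∷ 5F ∷ [])
  ∷ ((0F , 3F , 4F) , 5F ∷ 0F ∷ 1F ∷ 3F ∷ 4F ∷ [])
  ∷ ((1F , 3F , 4F) , 0F ∷ 5F ∷ 1F ∷ 3F ∷ 4F ∷ [])
  ∷ ((2F , 3F , 4F) , 0F ∷ 1F ∷ 5F ∷ 3F ∷ 4F ∷ [])
  ∷ []

missing : Fin 9 → Subset 5
missing t = let (i , j , k) , _ = lookup secondMissing t in triple i j k

intoG26 : Fin 9 → Fin 5 → Fin 6
intoG26 t = lookup (proj₂ (lookup secondMissing t))

abstract
  missing-exhaustive : ∀ i j k → edge K5minus i j k ≡ true → ∃ λ t → triple i j k ≡ missing t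
  missing-exhaustive = from-yes (all₃? λ i j k → (edge K5minus i j k 𝔹.≟ true) →-dec any? λ t → triple i j k ≟ˢ missing t)

  intoG26-edge : ∀ t i j k → Distinct i j k → triple i j k ≢ triple 0F 1F 2F → triple i j k ≢ missing t →
    edge G2six (intoG26 t i) (intoG26 t j) (intoG26 t k) ≡ true
  intoG26-edge = from-yes (all? λ t → all₃? λ i j k → distinct? i j k →-dec
    ¬? (triple i j k ≟ˢ triple 0F 1F 2F) →-dec ¬? (triple i j k ≟ˢ missing t) →-dec
    (edge G2six (intoG26 t i) (intoG26 t j) (intoG26 t k) 𝔹.≟ true))

edge-cong : ∀ (H : Graph3 n) (f : Fin m → Fin n) {i j k i′ j′ k′} → triple i j k ≡ triple i′ j′ k′ →
  edge H (f i) (f j) (f k) ≡ edge H (f i′) (f j′) (f k′)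
edge-cong H f eq = cong (λ S → is3 S ∧ H S)
  (trans (sym (image-triple f _ _ _)) (trans (cong (image f) eq) (image-triple f _ _ _)))

K5minus-free : ∀ (H : Graph3 n) → MFree H → ¬ (K5minus ⊂ H)
K5minus-free H free = free 5 K5minus (m1 (refl , λ S → id , id))

HomToG26 : (H : Graph3 n) (e : Fin m → Fin n) → Set
HomToG26 {m = m} H e = ∃ λ (f : Fin m → Fin 6) →
  ∀ i j k → edge H (e i) (e j) (e k) ≡ true → edge G2six (f i) (f j) (f k) ≡ true

twoMissing⇒hom : (H : Graph3 n) (e : Fin 5 → Fin n) → edge H (e 0F) (e 1F) (e 2F) ≢ true →
  ∀ {i j k} → edge K5minus i j k ≡ true → edge H (e i) (e j) (e k) ≢ true → HomToG26 H e
twoMissing⇒hom H e ¬012 {i} {j} {k} K5 ¬ijk = intoG26 t , λ x y z eq →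
  let (x≢y , x≢z , y≢z) = edge⇒distinct H eq in
  intoG26-edge t x y z (x≢y ∘ cong e , x≢z ∘ cong e , y≢z ∘ cong e)
    (λ same → ¬012 (trans (sym (edge-cong H e same)) eq))
    (λ same → ¬ijk (trans (edge-cong H e (trans eqt (sym same))) eq))
  where
  t = proj₁ (missing-exhaustive i j k K5)
  eqt = proj₂ (missing-exhaustive i j k K5)

-- With no triple or only one missing, `K5minus` would embed. So two are missing; once the first is
-- relabelled to 0, 1, 2, the second is one of nine, each with its map in `secondMissing`.
hom5 : (H : Graph3 n) → MFree H → (e : Fin 5 → Fin n) → Inj e → HomToG26 H e
hom5 H free e e-inj =
  [ (λ K5⊂H → contradiction (embedding K5minus H e-inj λ i j k eq → K5⊂H i j k (edge⇒distinct K5minus eq)) (K5minus-free H free))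
  , (λ { (a , b , c , abc , ¬edge) → missingOne ¬edge (relabel a b c abc) })
  ]′ (all₃-or-counterexample distinct? (λ i j k → edge H (e i) (e j) (e k) 𝔹.≟ true))
  where
  missingOne : ∀ {a b c} → edge H (e a) (e b) (e c) ≢ true → Relabelling a b c → HomToG26 H e
  missingOne {a} {b} {c} ¬abc R =
    [ (λ nine → contradiction (embedding K5minus H (σ-inj ∘ e-inj) nine) (K5minus-free H free))
    , (λ { (i , j , k , K5 , ¬ijk) → pullBack (twoMissing⇒hom H (e ∘ σ) ¬012 K5 ¬ijk) })
    ]′ (all₃-or-counterexample (λ i j k → edge K5minus i j k 𝔹.≟ true) (λ i j k → edge H (e (σ i)) (e (σ j)) (e (σ k)) 𝔹.≟ true))
    where
    open Relabelling R
    rename₃ : ∀ {x y z x′ y′ z′} → x ≡ x′ → y ≡ y′ → z ≡ z′ → edge H (e x) (e y) (e z) ≡ true → edge H (e x′) (e y′) (e z′) ≡ true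
    rename₃ refl refl refl = id
    ¬012 : edge H (e (σ 0F)) (e (σ 1F)) (e (σ 2F)) ≢ true
    ¬012 = ¬abc ∘ rename₃ σ0≡a σ1≡b σ2≡c
    τ : Fin 5 → Fin 5
    τ x = proj₁ (σ-surj x)
    στ : ∀ x → x ≡ σ (τ x)
    στ x = sym (proj₂ (σ-surj x))
    pullBack : HomToG26 H (e ∘ σ) → HomToG26 H e
    pullBack (f , hom) = f ∘ τ , λ x y z → hom (τ x) (τ y) (τ z) ∘ rename₃ (στ x) (στ y) (στ z)

-- Six vertices

G1⇒exactlyOne : ∀ (F : Graph3 m) N ((f , _) : F ⊂ G1 N) → ∀ i j k → edge F i j k ≡ true →
  toℕ (χ (setA N) (f i)) + (toℕ (χ (setA N) (f j)) + toℕ (χ (setA N) (f k))) ≡ 1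
G1⇒exactlyOne F N emb@(f , _) i j k eq = trans (sym (∣triple∩A∣ {i = f i} {f j} {f k} (setA N) (edge⇒distinct (G1 N) {f i} {f j} {f k} eq′)))
  (⌊⌋-true⁻ (proj₂ (edge⇒IsEdge {H = G1 N} {S = triple (f i) (f j) (f k)} eq′)))
  where eq′ = ⊂⇒edge F (G1 N) emb eq

edge-blowup⁻ : ∀ {s} (G : Graph3 s) (p : Fin n → Fin s) {i j k} →
  edge (blowup G p) i j k ≡ true → edge G (p i) (p j) (p k) ≡ true
edge-blowup⁻ G p {i} {j} {k} eq = subst (λ S → is3 S ∧ G S ≡ true) (image-triple p i j k)
  (proj₂ (edge⇒IsEdge {H = blowup G p} {S = triple i j k} eq))

edge-blowup⁺ : ∀ {s} (G : Graph3 s) (p : Fin n → Fin s) {i j k} →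
  edge G (p i) (p j) (p k) ≡ true → edge (blowup G p) i j k ≡ true
edge-blowup⁺ G p {i} {j} {k} eq = IsEdge⇒edge {H = blowup G p} {S = triple i j k}
  (∣triple∣ (i≢j ∘ cong p , i≢k ∘ cong p , j≢k ∘ cong p) , subst (λ S → is3 S ∧ G S ≡ true) (sym (image-triple p i j k)) eq)
  where
  d = edge⇒distinct G eq
  i≢j = proj₁ d
  i≢k = proj₁ (proj₂ d)
  j≢k = proj₂ (proj₂ d)

-- The size is kept a variable so that the 216-term sum is never unfolded.
bound6 : (H : Graph3 n) → MFree H → m ≡ 6 → (e : Fin m → Fin n) → Inj e → Covered H e → (w : Fin m → ℕ) → Bound H e w
-- The bound is decidable and follows from an embedding of `F` into any G¹ or G². If it failed, `F`
-- would have no such embedding and would lie in M₃.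
bound6 {m = m} H free m≡6 e e-inj cov w = decidable-stable (_ ℕ.≤? _) λ ¬bound →
  free m F (m3 (inK , (λ N _ → ¬bound ∘ viaG1 N) , λ N _ p _ → ¬bound ∘ viaG2 p)) (induced⊂ H e-inj)
  where
  F = induced H e
  inK : InK 6 F
  -- `21` is `6 + 6 C 2`; the core is the whole vertex set.
  inK = subst (_≤ 21) (sym m≡6) (ℕ.m≤m+n 6 15) , ⊤ , trans (∣⊤∣≡n m) m≡6 , λ x y _ _ x≢y → let z , eq = cov x y x≢y in
    triple x y z , edge⇒IsEdge {H = F} (edge-induced⁺ H eq) , ∈-triple⁺ (inj₁ refl) , ∈-triple⁺ {i = x} (inj₂ (inj₁ refl))
  viaG1 : ∀ N → F ⊂ G1 N → Bound H e w
  viaG1 N emb = exactlyOne-hom-bound w (χ (setA N) ∘ proj₁ emb) λ i j k eq → G1⇒exactlyOne F N emb i j k (edge-induced⁺ H eq)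
  viaG2 : ∀ {N} (p : Fin N → Fin 6) → F ⊂ blowup G2six p → Bound H e w
  viaG2 p emb = G26-hom-bound w (p ∘ proj₁ emb) λ i j k eq →
    edge-blowup⁻ G2six p (⊂⇒edge F (blowup G2six p) emb (edge-induced⁺ H eq))

-- At least seven vertices

-- A system without edges is a star at each of its vertices.
Star : (Fin m → Fin m → Fin m → Set) → Set
Star E = ∃ λ v → ∀ i j k → E i j k → v ∈₃ (i , j , k)

star? : {E : Fin m → Fin m → Fin m → Set} → (∀ i j k → Dec (E i j k)) → Dec (Star E)
star? E? = any? λ v → all₃? λ i j k → E? i j k →-dec (v ∈₃? (i , j , k))

2≤∣p∣ : ∀ {p : Subset n} {x y} → x ∈ p → y ∈ p → x ≢ y → 2 ≤ ∣ p ∣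
2≤∣p∣ {p = p} {x} {y} x∈p y∈p x≢y = subst (_≤ ∣ p ∣) (trans (∣⁅x⁆∪p∣ (x≢y⇒x∉⁅y⁆ x≢y)) (cong suc (∣⁅x⁆∣≡1 y)))
  (p⊆q⇒∣p∣≤∣q∣ λ z∈ → [ (λ z∈x → subst (_∈ p) (sym (x∈⁅y⁆⇒x≡y x z∈x)) x∈p)
                      , (λ z∈y → subst (_∈ p) (sym (x∈⁅y⁆⇒x≡y y z∈y)) y∈p) ]′ (x∈p∪q⁻ ⁅ x ⁆ ⁅ y ⁆ z∈))

-- One entry per unordered pair, 21 in all: with the seven core vertices this gives exactly the 28
-- vertices that M₂ permits.
increasingPairs : List (Fin 7 × Fin 7)
increasingPairs = filter (λ (i , j) → i Fin.<? j) (cartesianProduct (allFin 7) (allFin 7))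

-- The seven vertices and a third vertex for every pair induce a 3-graph with the seven as a core.
-- Freeness from M₂ then leaves a transversal of size at most one inside the core.
module SevenStar (H : Graph3 n) (g : Fin 7 → Fin n) (g-inj : Inj g)
  (third : Fin 7 → Fin 7 → Fin n) (third-edge : ∀ i j → i ≢ j → edge H (g i) (g j) (third i j) ≡ true) where

  vertices : List (Fin n)
  vertices = List.map g (allFin 7) ++ List.map (uncurry third) increasingPairs

  V : Subset n
  V = fromList vertices

  g∈V : ∀ i → g i ∈ V
  g∈V i = ∈-fromList {xs = vertices} (∈-++⁺ˡ (∈-map⁺ g (∈-allFin i)))

  third∈V : ∀ {i j} → i Data.Fin.< j → third i j ∈ V
  third∈V {i} {j} i<j = ∈-fromList {xs = vertices} (∈-++⁺ʳ (List.map g (allFin 7)) (∈-map⁺ (uncurry third)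
    (∈-filter⁺ (λ (i , j) → i Fin.<? j) (∈-cartesianProduct⁺ (∈-allFin i) (∈-allFin j)) i<j)))

  covering : ∀ i j → i ≢ j → ∃ λ x → x ∈ V × edge H (g i) (g j) x ≡ true
  covering i j i≢j with Fin.<-cmp i j
  ... | tri< i<j _ _ = third i j , third∈V i<j , third-edge i j i≢j
  ... | tri≈ _ i≡j _ = contradiction i≡j i≢j
  ... | tri> _ _ j<i = third j i , third∈V j<i , trans (edge-swap H (g i) (g j) (third j i)) (third-edge j i (i≢j ∘ sym))

  E = enumerate V
  ι = elem E
  F = induced H ι

  c : Fin 7 → Fin ∣ V ∣
  c i = proj₁ (index E (g∈V i))

  ιc : ∀ i → ι (c i) ≡ g i
  ιc i = proj₂ (index E (g∈V i))

  c-inj : Inj c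
  c-inj {i} {j} eq = g-inj (trans (sym (ιc i)) (trans (cong ι eq) (ιc j)))

  core : Subset ∣ V ∣
  core = image c ⊤

  edge-F : ∀ i j {x y} → ι x ≡ y → edge H (g i) (g j) y ≡ true → edge F (c i) (c j) x ≡ true
  edge-F i j {x} refl eq = edge-induced⁺ H (subst₂ (λ a b → edge H a b (ι x) ≡ true) (sym (ιc i)) (sym (ιc j)) eq)

  isCore : IsCore 7 F core
  isCore = ∣image⊤∣ c c-inj , λ x y x∈ y∈ x≢y → pairs (∈-image⁻ c ⊤ x∈) (∈-image⁻ c ⊤ y∈) x≢y
    where
    pairs : ∀ {x y} → (∃ λ i → i ∈ ⊤ × c i ≡ x) → (∃ λ j → j ∈ ⊤ × c j ≡ y) → x ≢ y → ∃ λ T → IsEdge F T × x ∈ T × y ∈ T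
    pairs (i , _ , refl) (j , _ , refl) x≢y =
      let z , z∈V , eq = covering i j (x≢y ∘ cong c)
          k , ιk = index E z∈V
      in triple (c i) (c j) k , edge⇒IsEdge {H = F} (edge-F i j ιk eq) ,
         ∈-triple⁺ (inj₁ refl) , ∈-triple⁺ {i = c i} (inj₂ (inj₁ refl))

  E₇ : Fin 7 → Fin 7 → Fin 7 → Set
  E₇ i j k = edge H (g i) (g j) (g k) ≡ true

  transversal⇒star : ∀ T → IsTransversalInduced F core T → ∀ v → (∀ {x} → x ∈ T → x ≡ c v) → Star E₇
  transversal⇒star T (T⊆core , hits) v T⊆v = v , λ i j k eq →
    let x , x∈ijk , x∈T = hits (triple (c i) (c j) (c k)) (edge⇒IsEdge {H = F} (edge-F i j (ιc k) eq)) (inCore i j k)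
    in hit (subst (_∈ triple (c i) (c j) (c k)) (T⊆v x∈T) x∈ijk)
    where
    inCore : ∀ i j k → triple (c i) (c j) (c k) ⊆ core
    inCore i j k = subst (_⊆ core) (image-triple c i j k) λ x∈ →
      let y , _ , cy≡x = ∈-image⁻ c (triple i j k) x∈ in subst (_∈ core) cy≡x (∈-image⁺ c ⊤ ∈⊤)
    hit : ∀ {i j k} → c v ∈ triple (c i) (c j) (c k) → v ∈₃ (i , j , k)
    hit x∈ = Sum.map c-inj (Sum.map c-inj c-inj) (∈-triple⁻ x∈)

  τ≥2 : ¬ Star E₇ → TauInducedGe 2 F core
  τ≥2 ¬star T trans′ = ℕ.≮⇒≥ λ ∣T∣<2 → ¬star (smallTransversal ∣T∣<2 (nonempty? T))
    where
    smallTransversal : ∣ T ∣ < 2 → Dec (∃ λ x → x ∈ T) → Star E₇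
    -- An empty transversal means that the core spans no edge, so the centre `0F` is arbitrary.
    smallTransversal _ (no empty) = transversal⇒star T trans′ 0F λ x∈T → contradiction (_ , x∈T) empty
    smallTransversal ∣T∣<2 (yes (x , x∈T)) =
      let v , _ , cv≡x = ∈-image⁻ c ⊤ (proj₁ trans′ x∈T) in
      transversal⇒star T trans′ v λ {y} y∈T →
        trans (decidable-stable (y ≟ x) λ y≢x → ℕ.<⇒≱ ∣T∣<2 (2≤∣p∣ y∈T x∈T y≢x)) (sym cv≡x)

  sevenStar : MFree H → Star E₇
  sevenStar free = decidable-stable (star? λ i j k → edge H (g i) (g j) (g k) 𝔹.≟ true) λ ¬star →
    free ∣ V ∣ F (m2 (∣fromList∣≤ vertices , core , isCore , τ≥2 ¬star)) (induced⊂ H (elem-injective E))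

module _ {i j k : Fin m} where

  ∈₃⇒∈ˡ : ∀ {x L} → x ∈₃ (i , j , k) → x ∈ˡ (i ∷ j ∷ k ∷ L)
  ∈₃⇒∈ˡ (inj₁ refl) = here refl
  ∈₃⇒∈ˡ (inj₂ (inj₁ refl)) = there (here refl)
  ∈₃⇒∈ˡ (inj₂ (inj₂ refl)) = there (there (here refl))

infix 4 _⊆₃_
_⊆₃_ : (s t : Fin m × Fin m × Fin m) → Set
s ⊆₃ t = ∀ {x} → x ∈₃ s → x ∈₃ t

-- A Helly property for triple systems: it suffices to find a common vertex
-- for the edges inside each set of seven vertices.
module Helly (E : Fin m → Fin m → Fin m → Set) (E? : ∀ i j k → Dec (E i j k))
  (swap : ∀ {i j k} → E i j k → E j i k) (swapʳ : ∀ {i j k} → E i j k → E i k j)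
  (E-distinct : ∀ {i j k} → E i j k → Distinct i j k)
  (local : ∀ (L : List (Fin m)) → length L ≤ 7 →
     ∃ λ v → ∀ i j k → i ∈ˡ L → j ∈ˡ L → k ∈ˡ L → E i j k → v ∈₃ (i , j , k))
  where

  -- Lets a given vertex of an edge be named first; the inclusion carries non-membership over to the
  -- renamed edge.
  rotate : ∀ {i j k x} → E i j k → x ∈₃ (i , j , k) → ∃ λ p → ∃ λ q → E x p q × ((x , p , q) ⊆₃ (i , j , k))
  rotate e (inj₁ refl) = _ , _ , e , id
  rotate e (inj₂ (inj₁ refl)) = _ , _ , swap e ,
    λ { (inj₁ p) → inj₂ (inj₁ p) ; (inj₂ (inj₁ p)) → inj₁ p ; (inj₂ (inj₂ p)) → inj₂ (inj₂ p) }
  rotate e (inj₂ (inj₂ refl)) = _ , _ , swap (swapʳ e) ,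
    λ { (inj₁ p) → inj₂ (inj₂ p) ; (inj₂ (inj₁ p)) → inj₁ p ; (inj₂ (inj₂ p)) → inj₂ (inj₁ p) }

  rotateʳ : ∀ {i j k x} → E i j k → x ∈₃ (i , j , k) → x ≢ i → ∃ λ q → E i x q × ((i , x , q) ⊆₃ (i , j , k))
  rotateʳ e (inj₁ x≡i) x≢i = contradiction x≡i x≢i
  rotateʳ e (inj₂ (inj₁ refl)) _ = _ , e , id
  rotateʳ e (inj₂ (inj₂ refl)) _ = _ , swapʳ e ,
    λ { (inj₁ p) → inj₁ p ; (inj₂ (inj₁ p)) → inj₂ (inj₂ p) ; (inj₂ (inj₂ p)) → inj₂ (inj₁ p) }

  meet : ∀ {i j k i′ j′ k′} → E i j k → E i′ j′ k′ → ∃ λ x → x ∈₃ (i , j , k) × x ∈₃ (i′ , j′ , k′)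
  meet {i} {j} {k} {i′} {j′} {k′} e e′ =
    let v , star = local (i ∷ j ∷ k ∷ i′ ∷ j′ ∷ k′ ∷ []) (ℕ.m≤m+n 6 1) in
    v , star _ _ _ (here refl) (there (here refl)) (there (there (here refl))) e
      , star _ _ _ (there (there (there (here refl)))) (there (there (there (there (here refl)))))
                   (there (there (there (there (there (here refl)))))) e′

  Avoiding : Fin m → Set
  Avoiding v = ∃ λ i → ∃ λ j → ∃ λ k → E i j k × ¬ (v ∈₃ (i , j , k))

  -- Given an edge abc, the edges avoiding its vertices turn out to be bcs, caz,
  -- bau, and these four span at most six vertices without a common one.
  ¬avoidable : (∀ v → Avoiding v) → Fin m → ⊥
  ¬avoidable avoid v₀ with a , _ , _ , E₁ , _ ← avoid v₀
    with _ , _ , _ , E₂ , a∉E₂ ← avoid a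
    with b , b∈E₁ , b∈E₂ ← meet E₁ E₂
    with c , E₁ , _ ← rotateʳ E₁ b∈E₁ (λ { refl → a∉E₂ b∈E₂ })
    with r , s , E₂ , ⊆E₂ ← rotate E₂ b∈E₂ = step₁ E₁ E₂ (a∉E₂ ∘ ⊆E₂)
    where
    step₄ : ∀ {a b c s z u} → E a b c → E b c s → ¬ (a ∈₃ (b , c , s)) → E c a z → ¬ (b ∈₃ (c , a , z)) →
      E b a u → ¬ (c ∈₃ (b , a , u)) → ⊥
    step₄ {a} {b} {c} {s} {z} {u} E₁ E₂ a∉E₂ E₃ b∉E₃ E₄ c∉E₄
      with v , star ← local (a ∷ b ∷ c ∷ s ∷ z ∷ u ∷ []) (ℕ.m≤m+n 6 1)
      with star _ _ _ (here refl) (there (here refl)) (there (there (here refl))) E₁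
    ... | inj₁ refl = a∉E₂ (star _ _ _ (there (here refl)) (there (there (here refl))) (there (there (there (here refl)))) E₂)
    ... | inj₂ (inj₁ refl) = b∉E₃ (star _ _ _ (there (there (here refl))) (here refl) (there (there (there (there (here refl))))) E₃)
    ... | inj₂ (inj₂ refl) = c∉E₄ (star _ _ _ (there (here refl)) (here refl) (there (there (there (there (there (here refl)))))) E₄)

    -- The common vertex of `E₁`, `E₃`, `E₄` is neither `b` nor `c`, so it is `a`: the last two
    -- edges become `c a z` and `b a u`.
    step₃ : ∀ {a b c s t z l u} → E a b c → E b c s → ¬ (a ∈₃ (b , c , s)) → E c t z → ¬ (b ∈₃ (c , t , z)) →
      E b l u → ¬ (c ∈₃ (b , l , u)) → ⊥
    step₃ {a} {b} {c} {s} {t} {z} {l} {u} E₁ E₂ a∉E₂ E₃ b∉E₃ E₄ c∉E₄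
      with v , star ← local (a ∷ b ∷ c ∷ t ∷ z ∷ l ∷ u ∷ []) ℕ.≤-refl
      with v∈E₃ ← star _ _ _ (there (there (here refl))) (there (there (there (here refl)))) (there (there (there (there (here refl))))) E₃
         | v∈E₄ ← star _ _ _ (there (here refl)) (there (there (there (there (there (here refl)))))) (there (there (there (there (there (there (here refl))))))) E₄
      with star _ _ _ (here refl) (there (here refl)) (there (there (here refl))) E₁ | E-distinct E₁
    ... | inj₂ (inj₁ refl) | _ = b∉E₃ v∈E₃
    ... | inj₂ (inj₂ refl) | _ = c∉E₄ v∈E₄
    ... | inj₁ refl | a≢b , a≢c , _ with _ , E₃′ , ⊆E₃ ← rotateʳ E₃ v∈E₃ a≢c with _ , E₄′ , ⊆E₄ ← rotateʳ E₄ v∈E₄ a≢b =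
      step₄ E₁ E₂ a∉E₂ E₃′ (b∉E₃ ∘ ⊆E₃) E₄′ (c∉E₄ ∘ ⊆E₄)

    -- A new edge `E₄` avoids `c`. Its common vertex with `E₁` and `E₂` is neither `a` nor `c`, so
    -- `E₄` contains `b`.
    step₂ : ∀ {a b c s t z} → E a b c → E b c s → ¬ (a ∈₃ (b , c , s)) → E c t z → ¬ (b ∈₃ (c , t , z)) → ⊥
    step₂ {a} {b} {c} {s} E₁ E₂ a∉E₂ E₃ b∉E₃
      with _ , _ , _ , E₄ , c∉E₄ ← avoid c
      with y , y∈E₁ , y∈E₄ ← meet E₁ E₄
      with l , u , E₄ , ⊆E₄ ← rotate E₄ y∈E₄
      with v , star ← local (a ∷ b ∷ c ∷ s ∷ l ∷ u ∷ []) (ℕ.m≤m+n 6 1)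
      with v∈E₂ ← star _ _ _ (there (here refl)) (there (there (here refl))) (there (there (there (here refl)))) E₂
         | v∈E₄ ← star _ _ _ (∈₃⇒∈ˡ y∈E₁) (there (there (there (there (here refl))))) (there (there (there (there (there (here refl)))))) E₄
      with star _ _ _ (here refl) (there (here refl)) (there (there (here refl))) E₁
    ... | inj₁ refl = a∉E₂ v∈E₂
    ... | inj₂ (inj₂ refl) = c∉E₄ (⊆E₄ v∈E₄)
    ... | inj₂ (inj₁ refl) with _ , _ , E₄′ , ⊆E₄′ ← rotate E₄ v∈E₄ =
      step₃ E₁ E₂ a∉E₂ E₃ b∉E₃ E₄′ (c∉E₄ ∘ ⊆E₄ ∘ ⊆E₄′)

    -- A new edge `E₃` avoids `b`. Since `E₃` meets `E₁`, the three edges span at most seven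
    -- vertices; their common vertex is neither `a` nor `b`, so both `E₂` and `E₃` contain `c`.
    step₁ : ∀ {a b c r s} → E a b c → E b r s → ¬ (a ∈₃ (b , r , s)) → ⊥
    step₁ {a} {b} {c} {r} {s} E₁ E₂ a∉E₂
      with _ , _ , _ , E₃ , b∉E₃ ← avoid b
      with y , y∈E₁ , y∈E₃ ← meet E₁ E₃
      with t , z , E₃ , ⊆E₃ ← rotate E₃ y∈E₃
      with v , star ← local (a ∷ b ∷ c ∷ r ∷ s ∷ t ∷ z ∷ []) ℕ.≤-refl
      with v∈E₂ ← star _ _ _ (there (here refl)) (there (there (there (here refl)))) (there (there (there (there (here refl))))) E₂
         | v∈E₃ ← star _ _ _ (∈₃⇒∈ˡ y∈E₁) (there (there (there (there (there (here refl)))))) (there (there (there (there (there (there (here refl))))))) E₃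
      with star _ _ _ (here refl) (there (here refl)) (there (there (here refl))) E₁ | E-distinct E₁
    ... | inj₁ refl | _ = a∉E₂ v∈E₂
    ... | inj₂ (inj₁ refl) | _ = b∉E₃ (⊆E₃ v∈E₃)
    ... | inj₂ (inj₂ refl) | _ , _ , b≢c with _ , E₂′ , ⊆E₂ ← rotateʳ E₂ v∈E₂ (b≢c ∘ sym) with _ , _ , E₃′ , ⊆E₃′ ← rotate E₃ v∈E₃ =
      step₂ E₁ E₂′ (a∉E₂ ∘ ⊆E₂) E₃′ (b∉E₃ ∘ ⊆E₃ ∘ ⊆E₃′)

  commonVertex : Fin m → Star E
  commonVertex v₀ = decidable-stable (star? E?) λ ¬star → ¬avoidable (λ v →
    [ (λ all → contradiction (v , all) ¬star) , id ]′ (all₃-or-counterexample E? (λ i j k → v ∈₃? (i , j , k)))) v₀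

-- With `A` consisting of the centre alone, every edge has exactly one vertex in `A`.
star⇒bound : (H : Graph3 n) (e : Fin m → Fin n) (w : Fin m → ℕ) →
  Star (λ i j k → edge H (e i) (e j) (e k) ≡ true) → Bound H e w
star⇒bound H e w (v , star) = exactlyOne-hom-bound w (χ ⁅ v ⁆) λ i j k eq →
  let (i≢j , i≢k , j≢k) = edge⇒distinct H eq in
  count (i≢j ∘ cong e , i≢k ∘ cong e , j≢k ∘ cong e) (star i j k eq)
  where
  in-v : χ ⁅ v ⁆ v ≡ 1F
  in-v = χ-∈ (x∈⁅x⁆ v)
  not-v : ∀ {x} → x ≢ v → χ ⁅ v ⁆ x ≡ 0F
  not-v x≢v = χ-∉ (x≢y⇒x∉⁅y⁆ x≢v)
  count : ∀ {i j k} → Distinct i j k → v ∈₃ (i , j , k) → toℕ (χ ⁅ v ⁆ i) + (toℕ (χ ⁅ v ⁆ j) + toℕ (χ ⁅ v ⁆ k)) ≡ 1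
  count (i≢j , i≢k , _) (inj₁ refl) rewrite in-v | not-v (i≢j ∘ sym) | not-v (i≢k ∘ sym) = refl
  count (i≢j , _ , j≢k) (inj₂ (inj₁ refl)) rewrite in-v | not-v i≢j | not-v (j≢k ∘ sym) = refl
  count (_ , i≢k , j≢k) (inj₂ (inj₂ refl)) rewrite in-v | not-v i≢k | not-v j≢k = refl

-- The list is padded to a set of exactly seven vertices, whose star centre also serves the list.
localStar : (H : Graph3 n) → MFree H → 7 ≤ m → (e : Fin m → Fin n) → Inj e → Covered H e →
  ∀ (L : List (Fin m)) → length L ≤ 7 →
  ∃ λ v → ∀ i j k → i ∈ˡ L → j ∈ˡ L → k ∈ˡ L → edge H (e i) (e j) (e k) ≡ true → v ∈₃ (i , j , k)
localStar {n} {m} H free 7≤m e e-inj cov L L≤7 =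
  let S , L⊆S , ∣S∣≡7 = enlarge (fromList L) (ℕ.≤-trans (∣fromList∣≤ L) L≤7) 7≤m
  in within S L⊆S (subst (Enumeration S) ∣S∣≡7 (enumerate S))
  where
  within : ∀ S → fromList L ⊆ S → Enumeration S 7 →
    ∃ λ v → ∀ i j k → i ∈ˡ L → j ∈ˡ L → k ∈ˡ L → edge H (e i) (e j) (e k) ≡ true → v ∈₃ (i , j , k)
  within S L⊆S En = elem En v , λ i j k i∈ j∈ k∈ eq → lift (idx i∈) (idx j∈) (idx k∈) eq
    where
    third : ∀ i j → ∃ λ x → i ≢ j → edge H (e (elem En i)) (e (elem En j)) x ≡ true
    third i j with i ≟ j
    -- On the diagonal any value will do, since the claim about it assumes `i ≢ j`.
    ... | yes i≡j = e (elem En i) , λ i≢j → contradiction i≡j i≢j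
    ... | no i≢j = let k , eq = cov (elem En i) (elem En j) (i≢j ∘ elem-injective En) in e k , λ _ → eq
    star = SevenStar.sevenStar H (e ∘ elem En) (elem-injective En ∘ e-inj)
      (λ i j → proj₁ (third i j)) (λ i j → proj₂ (third i j)) free
    v = proj₁ star
    idx : ∀ {x} → x ∈ˡ L → ∃ λ i → elem En i ≡ x
    idx x∈ = index En (L⊆S (∈-fromList x∈))
    lift : ∀ {i j k} → (∃ λ i′ → elem En i′ ≡ i) → (∃ λ j′ → elem En j′ ≡ j) → (∃ λ k′ → elem En k′ ≡ k) →
      edge H (e i) (e j) (e k) ≡ true → elem En v ∈₃ (i , j , k)
    lift (i′ , refl) (j′ , refl) (k′ , refl) eq =
      Sum.map (cong (elem En)) (Sum.map (cong (elem En)) (cong (elem En))) (proj₂ star i′ j′ k′ eq)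

bound≥7 : (H : Graph3 n) → MFree H → 7 ≤ m → (e : Fin m → Fin n) → Inj e → Covered H e → (w : Fin m → ℕ) → Bound H e w
bound≥7 H free 7≤m e e-inj cov w = star⇒bound H e w
  (Helly.commonVertex (λ i j k → edge H (e i) (e j) (e k) ≡ true) (λ i j k → edge H (e i) (e j) (e k) 𝔹.≟ true)
    (λ {i} {j} {k} eq → trans (edge-swap H (e j) (e i) (e k)) eq) (λ {i} {j} {k} eq → trans (edge-swapʳ H (e i) (e k) (e j)) eq)
    (λ eq → let (i≢j , i≢k , j≢k) = edge⇒distinct H eq in i≢j ∘ cong e , i≢k ∘ cong e , j≢k ∘ cong e)
    (localStar H free 7≤m e e-inj cov) (fromℕ< (ℕ.<-≤-trans (s≤s z≤n) 7≤m)))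

hom5′ : (H : Graph3 n) → MFree H → m ≡ 5 → (e : Fin m → Fin n) → Inj e → HomToG26 H e
hom5′ H free refl = hom5 H free

covered-bound : (H : Graph3 n) → MFree H → (e : Fin m → Fin n) → Inj e → Covered H e → (w : Fin m → ℕ) → Bound H e w
covered-bound {m = m} H free e e-inj cov w with ℕ.<-cmp m 5
... | tri< m<5 _ _ = bound≤4 H e w (ℕ.≤-pred m<5)
... | tri≈ _ m≡5 _ = let f , hom = hom5′ H free m≡5 e e-inj in G26-hom-bound w f hom
... | tri> _ _ 5<m with ℕ.m≤n⇒m<n∨m≡n 5<m
... | inj₁ 6<m = bound≥7 H free 6<m e e-inj cov w
... | inj₂ 6≡m = bound6 H free (sym 6≡m) e e-inj cov w

-- From weighted bounds to edge counts

sum-one : ∀ n → sum {n} (λ _ → 1) ≡ n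
sum-one zero = refl
sum-one (suc n) = cong suc (sum-one n)

-- Ordered triples count every edge six times, which turns the constant `12` into `2`.
numEdges-bound : (H : Graph3 n) → 27 * form (λ _ → 1) (edgeℕ H) ≤ 12 * sum {n} (λ _ → 1) ^ 3 → 27 * numEdges H ≤ 2 * n ^ 3
numEdges-bound {n} H le = ℕ.*-cancelˡ-≤ 6 (begin
  6 * (27 * numEdges H)            ≡⟨ left (numEdges H) ⟩
  27 * (6 * numEdges H)            ≡⟨ cong (27 *_) (6*numEdges H) ⟨
  27 * form (λ _ → 1) (edgeℕ H)    ≤⟨ le ⟩
  12 * sum {n} (λ _ → 1) ^ 3       ≡⟨ cong (λ t → 12 * t ^ 3) (sum-one n) ⟩
  12 * n ^ 3                       ≡⟨ ℕ.*-assoc 6 2 (n ^ 3) ⟩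
  6 * (2 * n ^ 3)                  ∎)
  where
  open ℕ.≤-Reasoning
  left : ∀ x → 6 * (27 * x) ≡ 27 * (6 * x)
  left = solve-∀

upperBound : (H : Graph3 n) → MFree H → 27 * numEdges H ≤ 2 * n ^ 3
upperBound {n} H free = numEdges-bound H (ℕ.≤-trans (ℕ.*-monoʳ-≤ 27 value≤)
  (subst (λ t → 27 * form weight (restrict (edgeℕ H) vertex) ≤ 12 * t ^ 3) sum-weight
    (covered-bound H free vertex vertex-injective covered weight)))
  where open CoveredWeighting (symmetrise n H id id (λ _ → 1))

-- The balanced blowup of G²₆

-- The residue modulo six, read off block by block, so every part has size `q`.
balanced : ∀ q → Fin (q * 6) → Fin 6
balanced (suc q) i = [ id , balanced q ]′ (splitAt 6 i)

balanced-surjective : ∀ q → Surjective' (balanced (suc q))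
balanced-surjective q y = y ↑ˡ (q * 6) , cong [ id , balanced q ]′ (splitAt-↑ˡ 6 y (q * 6))

sum-balanced : ∀ q (f : Fin 6 → ℕ) → ⟪ (λ _ → 1) , f ∘ balanced q ⟫ ≡ q * sum f
sum-balanced zero f = refl
sum-balanced (suc q) f = trans
  (cong (λ t → 1 * f 0F + (1 * f 1F + (1 * f 2F + (1 * f 3F + (1 * f 4F + (1 * f 5F + t)))))) (sum-balanced q f))
  (regroup (f 0F) (f 1F) (f 2F) (f 3F) (f 4F) (f 5F) (q * sum f))
  where
  regroup : ∀ a b c d e f t → 1 * a + (1 * b + (1 * c + (1 * d + (1 * e + (1 * f + t))))) ≡
    a + (b + (c + (d + (e + (f + 0))))) + t
  regroup = solve-∀

edge-blowup : ∀ {s} (G : Graph3 s) (p : Fin n → Fin s) i j k → edge (blowup G p) i j k ≡ edge G (p i) (p j) (p k)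
edge-blowup G p i j k with edge G (p i) (p j) (p k) in eq
... | true = edge-blowup⁺ G p eq
... | false = ¬-not λ eq′ → contradiction (trans (sym (edge-blowup⁻ G p eq′)) eq) λ ()

-- `96 = 6 * 16`: each of the sixteen edges of `G2six` yields `q ^ 3` triples, each counted in six
-- orders.
form-balanced : ∀ q → form (λ _ → 1) (edgeℕ (blowup G2six (balanced q))) ≡ 96 * q ^ 3
form-balanced q = begin
  form 𝟙 (edgeℕ (blowup G2six p))
    ≡⟨ form-cong 𝟙 (λ i j k → cong toNat (edge-blowup G2six p i j k)) ⟩
  form 𝟙 (restrict (edgeℕ G2six) p)
    ≡⟨ ⟪⟫-cong 𝟙 (λ i → ⟪⟫-cong 𝟙 λ j → sum-balanced q (edgeℕ G2six (p i) (p j))) ⟩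
  ⟪ 𝟙 , (λ i → ⟪ 𝟙 , (λ j → q * sum (edgeℕ G2six (p i) (p j))) ⟫) ⟫
    ≡⟨ ⟪⟫-cong 𝟙 (λ i → sum-balanced q (λ b → q * sum (edgeℕ G2six (p i) b))) ⟩
  ⟪ 𝟙 , (λ i → q * sum (λ b → q * sum (edgeℕ G2six (p i) b))) ⟫
    ≡⟨ sum-balanced q (λ a → q * sum (λ b → q * sum (edgeℕ G2six a b))) ⟩
  q * sum (λ a → q * sum (λ b → q * sum (edgeℕ G2six a b)))
    ≡⟨ prove (q ∷ []) (x :* ∑ₚ {m = 6} λ a → x :* ∑ₚ {m = 6} λ b → x :* con (sum (edgeℕ G2six a b)))
         (con 96 :* (x :* (x :* (x :* con 1)))) refl ⟩
  96 * q ^ 3 ∎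
  where
  open ≡-Reasoning
  open Polynomials
  p = balanced q
  𝟙 : Fin (q * 6) → ℕ
  𝟙 _ = 1
  x : Polynomial 1
  x = var 0F

numEdges-balanced : ∀ q → 27 * numEdges (blowup G2six (balanced q)) ≡ 2 * (q * 6) ^ 3
numEdges-balanced q = ℕ.*-cancelˡ-≡ _ _ 6 (begin
  6 * (27 * N)      ≡⟨ left N ⟩
  27 * (6 * N)      ≡⟨ cong (27 *_) (trans (sym (6*numEdges (blowup G2six (balanced q)))) (form-balanced q)) ⟩
  27 * (96 * q ^ 3) ≡⟨ right q ⟩
  6 * (2 * (q * 6) ^ 3) ∎)
  where
  open ≡-Reasoning
  N = numEdges (blowup G2six (balanced q))
  left : ∀ x → 6 * (27 * x) ≡ 27 * (6 * x)
  left = solve-∀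
  right : ∀ q → 27 * (96 * (q * (q * (q * 1)))) ≡ 6 * (2 * ((q * 6) * ((q * 6) * ((q * 6) * 1))))
  right = solve-∀

blowup-bound : (p : Fin n → Fin 6) → 27 * numEdges (blowup G2six p) ≤ 2 * n ^ 3
blowup-bound p = numEdges-bound (blowup G2six p) (G26-hom-bound (λ _ → 1) p λ i j k → edge-blowup⁻ G2six p)

-- No blowup exceeds `blowup-bound`, which the balanced one attains; `suc q` keeps all parts
-- nonempty.
balanced-max : ∀ q → IsMaxG2Blowup (suc q * 6) (balanced (suc q))
balanced-max q = balanced-surjective q , λ r _ → ℕ.*-cancelˡ-≤ 27
  (ℕ.≤-trans (blowup-bound r) (ℕ.≤-reflexive (sym (numEdges-balanced (suc q)))))

-- Freeness of the balanced blowup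

abstract
  -- Says that `K5minus`, with `a b c` as its missing triple, has no homomorphism to G²₆. Edge
  -- hypotheses are interleaved with the vertices so that the exhaustive search abandons a branch at
  -- the first non-edge.
  G26-K5minus-free : ∀ a b d → edge G2six a b d ≡ true →
    ∀ e → edge G2six a b e ≡ true → edge G2six a d e ≡ true → edge G2six b d e ≡ true →
    ∀ c → edge G2six a c d ≡ true → edge G2six a c e ≡ true → edge G2six b c d ≡ true → edge G2six b c e ≡ true →
    edge G2six c d e ≡ true → ⊥
  G26-K5minus-free = from-yes (all₃? λ a b d → E? a b d →-dec all? λ e → E? a b e →-dec E? a d e →-dec E? b d e →-dec
    all? λ c → E? a c d →-dec E? a c e →-dec E? b c d →-dec E? b c e →-dec E? c d e →-dec no λ ())
    where
    E? : ∀ i j k → Dec (edge G2six i j k ≡ true)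
    E? i j k = edge G2six i j k 𝔹.≟ true

module _ (p : Fin n → Fin 6) where

  private
    B = blowup G2six p

    edge-hom : ∀ (F : Graph3 m) ((f , _) : F ⊂ B) {i j k} → edge F i j k ≡ true → edge G2six (p (f i)) (p (f j)) (p (f k)) ≡ true
    edge-hom F emb eq = edge-blowup⁻ G2six p (⊂⇒edge F B emb eq)

  blowup-M1-free : ∀ {m} (F : Graph3 m) → InM1 F → ¬ (F ⊂ B)
  blowup-M1-free F (refl , iff) emb = G26-K5minus-free (φ 0F) (φ 1F) (φ 3F) (E 0F 1F 3F refl)
    (φ 4F) (E 0F 1F 4F refl) (E 0F 3F 4F refl) (E 1F 3F 4F refl)
    (φ 2F) (E 0F 2F 3F refl) (E 0F 2F 4F refl) (E 1F 2F 3F refl) (E 1F 2F 4F refl) (E 2F 3F 4F refl)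
    where
    φ : Fin 5 → Fin 6
    φ = p ∘ proj₁ emb
    E : ∀ i j k → edge K5minus i j k ≡ true → edge G2six (φ i) (φ j) (φ k) ≡ true
    E i j k eq = edge-hom F emb {i} {j} {k} (IsEdge⇒edge {H = F} {S = triple i j k}
      (proj₂ (iff (triple i j k)) (edge⇒IsEdge {H = K5minus} {S = triple i j k} eq)))

  -- Two core vertices share an edge, and an edge of the blowup meets three different parts, so the
  -- core occupies distinct parts among six.
  core≤6 : ∀ {m L} (F : Graph3 m) S → IsCore L F S → F ⊂ B → L ≤ 6
  core≤6 {m} F S (refl , cov) emb@(f , _) = ℕ.≮⇒≥ λ 6<L →
    let i , j , i<j , same = pigeonhole 6<L (p ∘ f ∘ elem E)
    in collide (cov (elem E i) (elem E j) (elem∈ E i) (elem∈ E j) (<⇒≢ i<j ∘ elem-injective E)) (<⇒≢ i<j ∘ elem-injective E) same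
    where
    E = enumerate S
    separated : ∀ {i j k x y} → Distinct (p (f i)) (p (f j)) (p (f k)) → x ∈₃ (i , j , k) → y ∈₃ (i , j , k) →
      p (f x) ≡ p (f y) → x ≡ y
    separated d (inj₁ refl) (inj₁ refl) eq = refl
    separated d (inj₁ refl) (inj₂ (inj₁ refl)) eq = contradiction eq (proj₁ d)
    separated d (inj₁ refl) (inj₂ (inj₂ refl)) eq = contradiction eq (proj₁ (proj₂ d))
    separated d (inj₂ (inj₁ refl)) (inj₁ refl) eq = contradiction (sym eq) (proj₁ d)
    separated d (inj₂ (inj₁ refl)) (inj₂ (inj₁ refl)) eq = refl
    separated d (inj₂ (inj₁ refl)) (inj₂ (inj₂ refl)) eq = contradiction eq (proj₂ (proj₂ d))
    separated d (inj₂ (inj₂ refl)) (inj₁ refl) eq = contradiction (sym eq) (proj₁ (proj₂ d))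
    separated d (inj₂ (inj₂ refl)) (inj₂ (inj₁ refl)) eq = contradiction (sym eq) (proj₂ (proj₂ d))
    separated d (inj₂ (inj₂ refl)) (inj₂ (inj₂ refl)) eq = refl
    separates : ∀ {x y i j k} → IsEdge F (triple i j k) → x ∈ triple i j k → y ∈ triple i j k → p (f x) ≡ p (f y) → x ≡ y
    separates T-edge x∈T y∈T =
      separated (edge⇒distinct G2six (edge-hom F emb (IsEdge⇒edge {H = F} T-edge))) (∈-triple⁻ x∈T) (∈-triple⁻ y∈T)
    collide : ∀ {x y} → (∃ λ T → IsEdge F T × x ∈ T × y ∈ T) → x ≢ y → p (f x) ≢ p (f y)
    collide {x} {y} (T , T-edge , x∈T , y∈T) x≢y same =
      let i , j , k , T≡ijk = size3⇒triple T (proj₁ T-edge) in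
      x≢y (separates {i = i} {j} {k} (subst (IsEdge F) T≡ijk T-edge) (subst (x ∈_) T≡ijk x∈T) (subst (y ∈_) T≡ijk y∈T) same)

balanced-free : ∀ q → MFree (blowup G2six (balanced (suc q)))
balanced-free q m F (m1 F∈M1) = blowup-M1-free (balanced (suc q)) F F∈M1
balanced-free q m F (m2 (_ , S , core , _)) emb = ℕ.<-irrefl refl (core≤6 (balanced (suc q)) F S core emb)
balanced-free q m F (m3 (_ , _ , ⊄G2)) = ⊄G2 (suc q * 6) (ℕ.m≤m+n 6 (q * 6)) (balanced (suc q)) (balanced-max q)

theorem1p7 : ((n : ℕ) → n ≥ 1 → (H : Graph3 n) → MFree H → 27 * numEdges H ≤ 2 * n ^ 3)
    × ((n : ℕ) → n ≥ 1 → 6 ∣ n → Σ (Graph3 n) λ H → MFree H × 27 * numEdges H ≡ 2 * n ^ 3)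
theorem1p7 = (λ n _ H → upperBound H) , λ
  -- A zero quotient is impossible because `n ≥ 1`.
  { _ _ (divides (suc q) refl) → blowup G2six (balanced (suc q)) , balanced-free q , numEdges-balanced (suc q) }
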